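{- Let $d\ge 1$ and $q\ge 2$ be integers. The Hamming graph $H(d,q)$ is periodic if and only if $(d,q)\in\{(1,2),(1,3),(2,2),(3,3),(4,2)\}$.
   Context: The Hamming graph $H(d,q)$: let $F$ be a set with $q$ elements; the vertex set is $F^d$, and two vertices $x=(x_1,\dots,x_d)$, $y=(y_1,\dots,y_d)$ are adjacent iff they differ in exactly one coordinate. For a finite simple graph $G=(V,E)$, let $\mathcal{A}(G)=\{(u,v),(v,u) : uv\in E\}$ be its set of symmetric arcs; for an arc $e=(u,v)$ write $o(e)=u$, $t(e)=v$, $e^{ -1}=(v,u)$. The Grover transfer matrix $U=U(G)$ is indexed by $\mathcal{A}(G)$ with $U_{e,f}=2/\deg(t(f))$ if $t(f)=o(e)$ and $e\neq f^{ -1}$; $U_{e,f}=2/\deg(t(f))-1$ if $e=f^{ -1}$; $U_{e,f}=0$ otherwise. $G$ is periodic if $U^k=I$ for some positive integer $k$. -}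

module Defs where

open import Data.Nat using (ℕ; zero; suc)
import Data.Nat as ℕ
open import Data.Fin using (Fin; zero; suc)
import Data.Fin as Fin
open import Data.Vec using (Vec; []; _∷_)
import Data.Vec.Properties as VecP
open import Data.List using (List; []; _∷_; [_]; map; concatMap; filter; length; lookup; cartesianProduct; allFin)
open import Data.Product using (_×_; _,_; proj₁; proj₂; Σ; ∃)
open import Data.Bool using (if_then_else_)
open import Data.Integer using (+_)
open import Data.Rational using (ℚ; 0ℚ; 1ℚ; _/_; _+_; _*_; _-_)
open import Relation.Nullary using (does)
open import Relation.Binary using (DecidableEquality; Rel; Decidable)
open import Relation.Binary.PropositionalEquality using (_≡_)
import Data.Product.Properties as ProdP

-- Finite simple graphs, given by a list enumerating the vertex set (each
-- vertex once), decidable equality, and a decidable (symmetric,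
-- irreflexive) adjacency relation.

record FinGraph : Set₁ where
  field
    V        : Set
    _≟V_     : DecidableEquality V
    vertices : List V
    Adj      : Rel V _
    adj?     : Decidable Adj

module Grover (G : FinGraph) where
  open FinGraph G

  Pair : Set
  Pair = V × V

  o t : Pair → V
  o = proj₁
  t = proj₂

  _⁻¹ : Pair → Pair
  (u , v) ⁻¹ = (v , u)

  _≟P_ : DecidableEquality Pair
  _≟P_ = ProdP.≡-dec _≟V_ _≟V_

  arcs : List Pair
  arcs = filter (λ p → adj? (proj₁ p) (proj₂ p)) (cartesianProduct vertices vertices)

  nArcs : ℕ
  nArcs = length arcs

  arc : Fin nArcs → Pair
  arc = lookup arcs

  deg : V → ℕ
  deg v = length (filter (adj? v) vertices)

  -- 2 / n as a rational; the value at n = 0 is irrelevant (t(f) of an arc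
  -- always has positive degree)
  twoOver : ℕ → ℚ
  twoOver zero    = 0ℚ
  twoOver (suc n) = (+ 2) / suc n

  U : Fin nArcs → Fin nArcs → ℚ
  U i j =
    let e = arc i ; f = arc j in
    if does (e ≟P (f ⁻¹)) then twoOver (deg (t f)) - 1ℚ
    else if does (t f ≟V o e) then twoOver (deg (t f))
    else 0ℚ

  Mat : Set
  Mat = Fin nArcs → Fin nArcs → ℚ

  sumFin : (n : ℕ) → (Fin n → ℚ) → ℚ
  sumFin zero    f = 0ℚ
  sumFin (suc n) f = f zero + sumFin n (λ k → f (suc k))

  _⊗_ : Mat → Mat → Mat
  (A ⊗ B) i j = sumFin nArcs (λ k → A i k * B k j)

  I : Mat
  I i j = if does (i Fin.≟ j) then 1ℚ else 0ℚ

  _^_ : Mat → ℕ → Mat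
  A ^ zero  = I
  A ^ suc k = A ⊗ (A ^ k)

  Periodic : Set
  Periodic = ∃ λ k → (1 ℕ.≤ k) × ((i j : Fin nArcs) → (U ^ k) i j ≡ I i j)

allVecs : (q d : ℕ) → List (Vec (Fin q) d)
allVecs q zero    = [ [] ]
allVecs q (suc d) = concatMap (λ a → map (a ∷_) (allVecs q d)) (allFin q)

hdist : {q d : ℕ} → Vec (Fin q) d → Vec (Fin q) d → ℕ
hdist []       []       = 0
hdist (a ∷ x) (b ∷ y) = (if does (a Fin.≟ b) then 0 else 1) ℕ.+ hdist x y

Hamming : (d q : ℕ) → FinGraph
Hamming d q = record
  { V        = Vec (Fin q) d
  ; _≟V_     = VecP.≡-dec Fin._≟_
  ; vertices = allVecs q d
  ; Adj      = λ x y → hdist x y ≡ 1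
  ; adj?     = λ x y → hdist x y ℕ.≟ 1
  }

IsPeriodic : FinGraph → Set
IsPeriodic G = Grover.Periodic G

{-# OPTIONS --safe #-}

-- Write c = 2 / degree.  If X is a column of a power of U, then U X (u , v) = c in(X)(u) - X (v , u),
-- where in(X)(u) sums X over the arcs ending in u.  Hence the vertex functions P n = in(U ^ (n - 1) X)
-- satisfy the Chebyshev recurrence P (n + 2) = c A P (n + 1) - P n, with A the adjacency operator,
-- and P 0, P 1 are the indicators of the two ends of the arc that indexes the column.
--
-- Necessity: pairing P n with an eigenvector of A for the eigenvalue d (q - 1) - q gives monic integer
-- polynomials in s = 2 - 2 q / (d (q - 1)), so U ^ k = I makes s an algebraic integer, hence an
-- integer.  Thus d (q - 1) divides 2 q, which leaves the five exceptional pairs.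
--
-- Sufficiency: U ^ 12 = I in all five cases.  U ^ 2m X differs from X by sums of values of P, and P is a
-- combination of radial functions, on which A acts by a (d + 1) × (d + 1) tridiagonal matrix, so
-- that finitely many rational numbers have to be evaluated.
module Submission where

open import Defs
open import Data.Bool using (Bool; true; false; not; if_then_else_)
import Data.Bool.Properties as Bool
open import Data.Fin as Fin using (Fin; zero; suc)
import Data.Fin.Properties as Fin
open import Data.Integer as ℤ using (ℤ)
import Data.Integer.Coprimality as ℤ
import Data.Integer.Divisibility as ℤ
import Data.Integer.Divisibility.Signed as Signed
import Data.Integer.Properties as ℤ
open import Data.Integer.Tactic.RingSolver using (solve-∀)
open import Data.List using (List; []; _∷_; _++_; map; concatMap; filter; length; lookup; cartesianProduct; cartesianProductWith; allFin)
open import Data.List.Membership.Propositional using (_∈_)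
open import Data.List.Membership.Propositional.Properties
open import Data.List.Properties using (length-tabulate)
open import Data.List.Relation.Unary.All as All using (All; []; _∷_)
open import Data.List.Relation.Unary.AllPairs using ([]; _∷_)
open import Data.List.Relation.Unary.Any as Any using (here; there)
open import Data.List.Relation.Unary.Any.Properties using (lookup-index)
open import Data.List.Relation.Unary.Unique.Propositional using (Unique)
import Data.List.Relation.Unary.Unique.Propositional.Properties as Unique
open import Data.Nat as ℕ using (ℕ; zero; suc; _≤_)
open import Data.Nat.Divisibility as ℕ using (_∣_)
import Data.Nat.Properties as ℕ
open import Data.Product using (_×_; _,_; proj₁; proj₂; ∃)
open import Data.Rational using (ℚ; mkℚ; 0ℚ; 1ℚ; _/_; _+_; _*_; _-_; -_; ↥_; ↧_; toℚᵘ)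
open import Data.Rational.Properties
open import Data.Rational.Solver using (module +-*-Solver)
import Data.Rational.Unnormalised as ℚᵘ
import Data.Rational.Unnormalised.Properties as ℚᵘ
open import Data.Sum using (_⊎_; inj₁; inj₂)
open import Data.Vec as Vec using (Vec; []; _∷_)
import Data.Vec.Properties as Vec
open import Function using (_∘_; id)
open import Function.Bundles using (_⇔_; mk⇔)
open import Relation.Binary using (DecidableEquality)
open import Relation.Binary.PropositionalEquality
open import Relation.Nullary using (Dec; does; yes; no; ¬_; contradiction)
open import Relation.Nullary.Decidable using (True; toWitness; from-no; recompute; dec-true; dec-false; _×-dec_)
open import Relation.Unary using (Pred; Decidable)

open +-*-Solver using (solve; _:=_; _:+_; _:*_; _:-_; :-_; con)

-- The embedding of the integers into the rationals

ι : ℤ → ℚ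
ι i = i / 1

ℕ→ℚ : ℕ → ℚ
ℕ→ℚ n = ι (ℤ.+ n)

toℚᵘ-ι : ∀ i → toℚᵘ (ι i) ℚᵘ.≃ ℚᵘ.mkℚᵘ i 0
toℚᵘ-ι i = toℚᵘ-fromℚᵘ (ℚᵘ.mkℚᵘ i 0)

-- Addition on `ℚ` normalises through a gcd, which is stuck on variables; in the unnormalised
-- rationals the equation is a cross multiplication.
ι-+ : ∀ i j → ι (i ℤ.+ j) ≡ ι i + ι j
ι-+ i j = toℚᵘ-injective (begin
  toℚᵘ (ι (i ℤ.+ j))                  ≈⟨ toℚᵘ-ι (i ℤ.+ j) ⟩
  ℚᵘ.mkℚᵘ (i ℤ.+ j) 0                 ≈⟨ ℚᵘ.*≡* (cong (ℤ._* ℤ.+ 1) (sym (cong₂ ℤ._+_ (ℤ.*-identityʳ i) (ℤ.*-identityʳ j)))) ⟩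
  ℚᵘ.mkℚᵘ i 0 ℚᵘ.+ ℚᵘ.mkℚᵘ j 0        ≈⟨ ℚᵘ.+-cong (toℚᵘ-ι i) (toℚᵘ-ι j) ⟨
  toℚᵘ (ι i) ℚᵘ.+ toℚᵘ (ι j)          ≈⟨ toℚᵘ-homo-+ (ι i) (ι j) ⟨
  toℚᵘ (ι i + ι j)                    ∎)
  where open ℚᵘ.≃-Reasoning

ι-* : ∀ i j → ι (i ℤ.* j) ≡ ι i * ι j
ι-* i j = toℚᵘ-injective (begin
  toℚᵘ (ι (i ℤ.* j))                  ≈⟨ toℚᵘ-ι (i ℤ.* j) ⟩
  ℚᵘ.mkℚᵘ i 0 ℚᵘ.* ℚᵘ.mkℚᵘ j 0        ≈⟨ ℚᵘ.*-cong (toℚᵘ-ι i) (toℚᵘ-ι j) ⟨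
  toℚᵘ (ι i) ℚᵘ.* toℚᵘ (ι j)          ≈⟨ toℚᵘ-homo-* (ι i) (ι j) ⟨
  toℚᵘ (ι i * ι j)                    ∎)
  where open ℚᵘ.≃-Reasoning

ι-neg : ∀ i → ι (ℤ.- i) ≡ - ι i
ι-neg (ℤ.+ zero)    = refl
ι-neg (ℤ.+ (suc n)) = refl
ι-neg ℤ.-[1+ n ]    = solve 1 (λ x → x := :- (:- x)) refl (ℕ→ℚ (suc n))

ι-injective : ∀ {i j} → ι i ≡ ι j → i ≡ j
ι-injective {i} {j} eq with ℚᵘ.≃-trans (ℚᵘ.≃-sym (toℚᵘ-ι i)) (ℚᵘ.≃-trans (ℚᵘ.≃-reflexive (cong toℚᵘ eq)) (toℚᵘ-ι j))
... | ℚᵘ.*≡* i*1≡j*1 = ℤ.*-cancelʳ-≡ i j (ℤ.+ 1) i*1≡j*1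

ℕ→ℚ-suc : ∀ n → ℕ→ℚ (suc n) ≡ 1ℚ + ℕ→ℚ n
ℕ→ℚ-suc n = ι-+ (ℤ.+ 1) (ℤ.+ n)

/-* : ∀ i n → (i / suc n) * ℕ→ℚ (suc n) ≡ ι i
/-* i n = toℚᵘ-injective (begin
  toℚᵘ ((i / suc n) * ℕ→ℚ (suc n))            ≈⟨ toℚᵘ-homo-* (i / suc n) (ℕ→ℚ (suc n)) ⟩
  toℚᵘ (i / suc n) ℚᵘ.* toℚᵘ (ℕ→ℚ (suc n))    ≈⟨ ℚᵘ.*-cong (toℚᵘ-fromℚᵘ (ℚᵘ.mkℚᵘ i n)) (toℚᵘ-ι (ℤ.+ suc n)) ⟩
  ℚᵘ.mkℚᵘ i n ℚᵘ.* ℚᵘ.mkℚᵘ (ℤ.+ suc n) 0        ≈⟨ ℚᵘ.*≡* (trans (ℤ.*-identityʳ (i ℤ.* ℤ.+ suc n)) (cong (λ m → i ℤ.* ℤ.+ m) (sym (ℕ.*-identityʳ (suc n))))) ⟩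
  ℚᵘ.mkℚᵘ i 0                                 ≈⟨ toℚᵘ-ι i ⟨
  toℚᵘ (ι i)                                  ∎)
  where open ℚᵘ.≃-Reasoning

-- Finite sums and indicators

private
  variable
    A B : Set

∑ : List A → (A → ℚ) → ℚ
∑ []       f = 0ℚ
∑ (x ∷ xs) f = f x + ∑ xs f

+-congˡ : ∀ p {q r} → q ≡ r → p + q ≡ p + r
+-congˡ p = cong (p +_)

*-congˡ : ∀ p {q r} → q ≡ r → p * q ≡ p * r
*-congˡ p = cong (p *_)

*-congʳ : ∀ p {q r} → q ≡ r → q * p ≡ r * p
*-congʳ p = cong (_* p)

infix 10 ∑
syntax ∑ xs (λ x → e) = ∑[ x ∈ xs ] e

∑-cong : ∀ (xs : List A) {f g : A → ℚ} → (∀ x → f x ≡ g x) → ∑ xs f ≡ ∑ xs g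
∑-cong []       f≗g = refl
∑-cong (x ∷ xs) f≗g = cong₂ _+_ (f≗g x) (∑-cong xs f≗g)

∑-0 : ∀ (xs : List A) → ∑[ x ∈ xs ] 0ℚ ≡ 0ℚ
∑-0 []       = refl
∑-0 (x ∷ xs) = trans (+-identityˡ _) (∑-0 xs)

∑-+ : ∀ (xs : List A) (f g : A → ℚ) → ∑[ x ∈ xs ] (f x + g x) ≡ ∑ xs f + ∑ xs g
∑-+ []       f g = refl
∑-+ (x ∷ xs) f g = trans (+-congˡ (f x + g x) (∑-+ xs f g))
  (solve 4 (λ a b c d → (a :+ b) :+ (c :+ d) := (a :+ c) :+ (b :+ d)) refl (f x) (g x) (∑ xs f) (∑ xs g))

∑-*ˡ : ∀ (xs : List A) a (f : A → ℚ) → ∑[ x ∈ xs ] (a * f x) ≡ a * ∑ xs f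
∑-*ˡ []       a f = sym (*-zeroʳ a)
∑-*ˡ (x ∷ xs) a f = trans (+-congˡ (a * f x) (∑-*ˡ xs a f)) (sym (*-distribˡ-+ a (f x) (∑ xs f)))

∑-*ʳ : ∀ (xs : List A) (f : A → ℚ) a → ∑[ x ∈ xs ] (f x * a) ≡ ∑ xs f * a
∑-*ʳ xs f a = trans (∑-cong xs λ x → *-comm (f x) a) (trans (∑-*ˡ xs a f) (*-comm a _))

∑-linear : ∀ (xs : List A) a (f g : A → ℚ) → ∑[ x ∈ xs ] (a * f x - g x) ≡ a * ∑ xs f - ∑ xs g
∑-linear []       a f g = solve 1 (λ a → con 0ℚ := a :* con 0ℚ :- con 0ℚ) refl a
∑-linear (x ∷ xs) a f g = trans (+-congˡ (a * f x - g x) (∑-linear xs a f g))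
  (solve 5 (λ a p q r s → (a :* p :- q) :+ (a :* r :- s) := a :* (p :+ r) :- (q :+ s)) refl a (f x) (g x) (∑ xs f) (∑ xs g))

∑-swap : ∀ (xs : List A) (ys : List B) (f : A → B → ℚ) →
         ∑[ x ∈ xs ] ∑[ y ∈ ys ] f x y ≡ ∑[ y ∈ ys ] ∑[ x ∈ xs ] f x y
∑-swap []       ys f = sym (∑-0 ys)
∑-swap (x ∷ xs) ys f = trans (+-congˡ (∑ ys (f x)) (∑-swap xs ys f)) (sym (∑-+ ys (f x) _))

∑-++ : ∀ (xs ys : List A) f → ∑ (xs ++ ys) f ≡ ∑ xs f + ∑ ys f
∑-++ []       ys f = sym (+-identityˡ _)
∑-++ (x ∷ xs) ys f = trans (+-congˡ (f x) (∑-++ xs ys f)) (sym (+-assoc (f x) (∑ xs f) (∑ ys f)))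

∑-map : ∀ (h : A → B) xs f → ∑ (map h xs) f ≡ ∑ xs (f ∘ h)
∑-map h []       f = refl
∑-map h (x ∷ xs) f = +-congˡ (f (h x)) (∑-map h xs f)

∑-concatMap : ∀ (h : A → List B) xs f → ∑ (concatMap h xs) f ≡ ∑[ x ∈ xs ] ∑ (h x) f
∑-concatMap h []       f = refl
∑-concatMap h (x ∷ xs) f = trans (∑-++ (h x) _ f) (+-congˡ (∑ (h x) f) (∑-concatMap h xs f))

∑-cartesianProduct : ∀ (xs : List A) (ys : List B) f →
                     ∑ (cartesianProduct xs ys) f ≡ ∑[ x ∈ xs ] ∑[ y ∈ ys ] f (x , y)
∑-cartesianProduct []       ys f = refl
∑-cartesianProduct (x ∷ xs) ys f = trans (∑-++ (map (x ,_) ys) _ f)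
  (cong₂ _+_ (∑-map (x ,_) ys f) (∑-cartesianProduct xs ys f))

-- Built from the same `if does` as the entries of `Grover.I`, so that these are brackets by
-- computation.
⟦_⟧ : ∀ {p} {P : Set p} → Dec P → ℚ
⟦ P? ⟧ = if does P? then 1ℚ else 0ℚ

⟦⟧-true : ∀ {p} {P : Set p} (P? : Dec P) → P → ⟦ P? ⟧ ≡ 1ℚ
⟦⟧-true P? x = cong (if_then 1ℚ else 0ℚ) (dec-true P? x)

⟦⟧-false : ∀ {p} {P : Set p} (P? : Dec P) → ¬ P → ⟦ P? ⟧ ≡ 0ℚ
⟦⟧-false P? x = cong (if_then 1ℚ else 0ℚ) (dec-false P? x)

⟦⟧-cong : ∀ {p q} {P : Set p} {Q : Set q} (P? : Dec P) (Q? : Dec Q) →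
          (P → Q) → (Q → P) → ⟦ P? ⟧ ≡ ⟦ Q? ⟧
⟦⟧-cong P? (yes x) f g = ⟦⟧-true P? (g x)
⟦⟧-cong P? (no ¬x) f g = ⟦⟧-false P? (¬x ∘ f)

⟦⟧-× : ∀ {p q r} {P : Set p} {Q : Set q} {R : Set r} (P? : Dec P) (Q? : Dec Q) (R? : Dec R) →
       (R → P × Q) → (P × Q → R) → ⟦ R? ⟧ ≡ ⟦ P? ⟧ * ⟦ Q? ⟧
⟦⟧-× (yes x) (yes y) R? f g = ⟦⟧-true R? (g (x , y))
⟦⟧-× (yes x) (no ¬y) R? f g = ⟦⟧-false R? (¬y ∘ proj₂ ∘ f)
⟦⟧-× (no ¬x) Q?      R? f g = trans (⟦⟧-false R? (¬x ∘ proj₁ ∘ f)) (sym (*-zeroˡ ⟦ Q? ⟧))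

∑-filter : ∀ {p} {P : Pred A p} (P? : Decidable P) xs f → ∑ (filter P? xs) f ≡ ∑[ x ∈ xs ] (⟦ P? x ⟧ * f x)
∑-filter P? []       f = refl
∑-filter P? (x ∷ xs) f with does (P? x)
... | true  = cong₂ _+_ (sym (*-identityˡ (f x))) (∑-filter P? xs f)
... | false = trans (∑-filter P? xs f) (trans (sym (+-identityˡ _)) (cong (_+ ∑[ y ∈ xs ] (⟦ P? y ⟧ * f y)) (sym (*-zeroˡ (f x)))))

∑-1 : ∀ (xs : List A) → ∑[ x ∈ xs ] 1ℚ ≡ ℕ→ℚ (length xs)
∑-1 []       = refl
∑-1 (x ∷ xs) = trans (cong (1ℚ +_) (∑-1 xs)) (sym (ℕ→ℚ-suc (length xs)))

module _ (_≟ᴬ_ : DecidableEquality A) where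

  ∑-sift-∉ : ∀ {a : A} {xs} (f : A → ℚ) → All (a ≢_) xs → ∑[ x ∈ xs ] (⟦ x ≟ᴬ a ⟧ * f x) ≡ 0ℚ
  ∑-sift-∉ f []           = refl
  ∑-sift-∉ {a} {x ∷ _} f (a≢x ∷ a∉xs) = cong₂ _+_
    (trans (*-congʳ (f x) (⟦⟧-false (x ≟ᴬ a) (a≢x ∘ sym))) (*-zeroˡ (f x)))
    (∑-sift-∉ f a∉xs)

  ∑-sift : ∀ {a : A} {xs} (f : A → ℚ) → Unique xs → a ∈ xs → ∑[ x ∈ xs ] (⟦ x ≟ᴬ a ⟧ * f x) ≡ f a
  ∑-sift {a} f (a∉xs ∷ _) (here refl) = trans (cong₂ _+_
    (trans (*-congʳ (f a) (⟦⟧-true (a ≟ᴬ a) refl)) (*-identityˡ (f a)))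
    (∑-sift-∉ f a∉xs)) (+-identityʳ (f a))
  ∑-sift {a} {x ∷ _} f (x∉xs ∷ xs!) (there a∈xs) = trans (cong₂ _+_
    (trans (*-congʳ (f x) (⟦⟧-false (x ≟ᴬ a) (All.lookup x∉xs a∈xs))) (*-zeroˡ (f x)))
    (∑-sift f xs! a∈xs)) (+-identityˡ (f a))

lookup-injective : ∀ {A : Set} {xs : List A} → Unique xs → ∀ i j → lookup xs i ≡ lookup xs j → i ≡ j
lookup-injective (x∉xs ∷ xs!) zero    zero    eq = refl
lookup-injective (x∉xs ∷ xs!) zero    (suc j) eq = contradiction eq (All.lookup x∉xs (∈-lookup j))
lookup-injective (x∉xs ∷ xs!) (suc i) zero    eq = contradiction (sym eq) (All.lookup x∉xs (∈-lookup i))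
lookup-injective (x∉xs ∷ xs!) (suc i) (suc j) eq = cong suc (lookup-injective xs! i j eq)

exchange : ∀ x y z → x * (y * z) ≡ y * (x * z)
exchange = solve 3 (λ x y z → x :* (y :* z) := y :* (x :* z)) refl

-- The Grover walk on a regular graph

module RegularGraph (G : FinGraph)
  (vertices! : Unique (FinGraph.vertices G)) (∈-vertices : ∀ v → v ∈ FinGraph.vertices G)
  (Adj-sym : ∀ {u v} → FinGraph.Adj G u v → FinGraph.Adj G v u)
  (k-1 : ℕ) (deg≡k : ∀ v → Grover.deg G v ≡ suc k-1) where

  open FinGraph G
  open Grover G

  private
    k c : ℚ
    k = ℕ→ℚ (suc k-1)
    c = twoOver (suc k-1)

  -- The degree is written `suc k-1`, so that `twoOver` reduces to its second clause.
  c*k≡2 : c * k ≡ 1ℚ + 1ℚ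
  c*k≡2 = /-* (ℤ.+ 2) k-1

  adjacency : (V → ℚ) → V → ℚ
  adjacency f u = ∑[ w ∈ vertices ] (⟦ adj? u w ⟧ * f w)

  adjacency-1 : ∀ u → adjacency (λ _ → 1ℚ) u ≡ k
  adjacency-1 u = begin
    adjacency (λ _ → 1ℚ) u            ≡⟨ ∑-filter (adj? u) vertices _ ⟨
    ∑ (filter (adj? u) vertices) (λ _ → 1ℚ) ≡⟨ ∑-1 (filter (adj? u) vertices) ⟩
    ℕ→ℚ (deg u)                       ≡⟨ cong ℕ→ℚ (deg≡k u) ⟩
    k                                 ∎
    where open ≡-Reasoning

  inflow outflow : (Pair → ℚ) → V → ℚ
  inflow  X u = ∑[ w ∈ vertices ] (⟦ adj? u w ⟧ * X (w , u))
  outflow X u = ∑[ w ∈ vertices ] (⟦ adj? u w ⟧ * X (u , w))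

  -- Defined on all pairs. Values at non-adjacent pairs are meaningless, but they never reach an
  -- arc: `inflow` masks them, and reversal preserves adjacency.
  step : (Pair → ℚ) → Pair → ℚ
  step X (u , v) = c * inflow X u - X (v , u)

  arcs! : Unique arcs
  arcs! = Unique.filter⁺ _ (Unique.cartesianProduct⁺ vertices! vertices!)

  ∈-arcs : ∀ {u v} → Adj u v → (u , v) ∈ arcs
  ∈-arcs {u} {v} u~v = ∈-filter⁺ _ (∈-cartesianProduct⁺ (∈-vertices u) (∈-vertices v)) u~v

  arc-adj : ∀ i → Adj (o (arc i)) (t (arc i))
  arc-adj i = proj₂ (∈-filter⁻ (λ p → adj? (proj₁ p) (proj₂ p)) {xs = cartesianProduct vertices vertices} (∈-lookup i))

  sumFin-lookup : ∀ (xs : List Pair) X → sumFin (length xs) (λ i → X (lookup xs i)) ≡ ∑ xs X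
  sumFin-lookup []       X = refl
  sumFin-lookup (x ∷ xs) X = +-congˡ (X x) (sumFin-lookup xs X)

  sumFin-cong : ∀ n {f g : Fin n → ℚ} → (∀ i → f i ≡ g i) → sumFin n f ≡ sumFin n g
  sumFin-cong zero    f≗g = refl
  sumFin-cong (suc n) f≗g = cong₂ _+_ (f≗g zero) (sumFin-cong n (f≗g ∘ suc))

  -- The cases of `U` in one linear formula: the inverse of `e` also ends at `o e`, so there both
  -- brackets are 1 and give `c - 1`.
  entry : Pair → Pair → ℚ
  entry e f = c * ⟦ t f ≟V o e ⟧ - ⟦ f ≟P (e ⁻¹) ⟧

  U≡entry : ∀ i j → U i j ≡ entry (arc i) (arc j)
  U≡entry i j rewrite deg≡k (t (arc j)) = lemma (arc i) (arc j)
    where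
    lemma : ∀ e f → (if does (e ≟P (f ⁻¹)) then c - 1ℚ else if does (t f ≟V o e) then c else 0ℚ) ≡ entry e f
    lemma e@(u , v) f@(w , x) with e ≟P (f ⁻¹)
    ... | yes refl = sym (cong₂ _-_ (trans (*-congˡ c (⟦⟧-true (u ≟V u) refl)) (*-identityʳ c)) (⟦⟧-true (f ≟P f) refl))
    ... | no e≢f⁻¹ rewrite ⟦⟧-false (f ≟P (e ⁻¹)) (e≢f⁻¹ ∘ cong _⁻¹ ∘ sym) with does (x ≟V u)
    ... | true  = solve 1 (λ c → c := c :* con 1ℚ :- con 0ℚ) refl c
    ... | false = solve 1 (λ c → con 0ℚ := c :* con 0ℚ :- con 0ℚ) refl c

  ∑-arcs-into : ∀ X a → ∑[ f ∈ arcs ] (⟦ t f ≟V a ⟧ * X f) ≡ inflow X a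
  ∑-arcs-into X a = begin
    ∑[ f ∈ arcs ] (⟦ t f ≟V a ⟧ * X f)
      ≡⟨ ∑-filter _ (cartesianProduct vertices vertices) _ ⟩
    ∑[ f ∈ cartesianProduct vertices vertices ] (⟦ adj? (o f) (t f) ⟧ * (⟦ t f ≟V a ⟧ * X f))
      ≡⟨ ∑-cartesianProduct vertices vertices _ ⟩
    ∑[ u ∈ vertices ] ∑[ v ∈ vertices ] (⟦ adj? u v ⟧ * (⟦ v ≟V a ⟧ * X (u , v)))
      ≡⟨ ∑-cong vertices (λ u → begin
           ∑[ v ∈ vertices ] (⟦ adj? u v ⟧ * (⟦ v ≟V a ⟧ * X (u , v)))
             ≡⟨ ∑-cong vertices (λ v → exchange ⟦ adj? u v ⟧ ⟦ v ≟V a ⟧ (X (u , v))) ⟩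
           ∑[ v ∈ vertices ] (⟦ v ≟V a ⟧ * (⟦ adj? u v ⟧ * X (u , v)))
             ≡⟨ ∑-sift _≟V_ _ vertices! (∈-vertices a) ⟩
           ⟦ adj? u a ⟧ * X (u , a)
             ≡⟨ *-congʳ _ (⟦⟧-cong (adj? u a) (adj? a u) Adj-sym Adj-sym) ⟩
           ⟦ adj? a u ⟧ * X (u , a)
             ∎) ⟩
    inflow X a ∎
    where open ≡-Reasoning

  U-apply : ∀ X i → sumFin nArcs (λ j → U i j * X (arc j)) ≡ step X (arc i)
  U-apply X i = begin
    sumFin nArcs (λ j → U i j * X (arc j))
      ≡⟨ sumFin-cong nArcs (λ j → *-congʳ _ (U≡entry i j)) ⟩
    sumFin nArcs (λ j → entry e (arc j) * X (arc j))
      ≡⟨ sumFin-lookup arcs (λ f → entry e f * X f) ⟩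
    ∑[ f ∈ arcs ] (entry e f * X f)
      ≡⟨ ∑-cong arcs (λ f → distribute c ⟦ t f ≟V o e ⟧ ⟦ f ≟P (e ⁻¹) ⟧ (X f)) ⟩
    ∑[ f ∈ arcs ] (c * (⟦ t f ≟V o e ⟧ * X f) - ⟦ f ≟P (e ⁻¹) ⟧ * X f)
      ≡⟨ ∑-linear arcs c _ _ ⟩
    c * (∑[ f ∈ arcs ] (⟦ t f ≟V o e ⟧ * X f)) - ∑[ f ∈ arcs ] (⟦ f ≟P (e ⁻¹) ⟧ * X f)
      ≡⟨ cong₂ (λ x y → c * x - y) (∑-arcs-into X (o e)) (∑-sift _≟P_ X arcs! (∈-arcs (Adj-sym (arc-adj i)))) ⟩
    step X e ∎
    where
    open ≡-Reasoning
    e = arc i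
    distribute : ∀ c x y z → (c * x - y) * z ≡ c * (x * z) - y * z
    distribute = solve 4 (λ c x y z → (c :* x :- y) :* z := c :* (x :* z) :- y :* z) refl

  evolve : Pair → ℕ → Pair → ℚ
  evolve e zero    f = ⟦ f ≟P e ⟧
  evolve e (suc n) = step (evolve e n)

  U^-column : ∀ n i j → (U ^ n) i j ≡ evolve (arc j) n (arc i)
  U^-column zero    i j = ⟦⟧-cong (i Fin.≟ j) (arc i ≟P arc j) (cong arc) (lookup-injective arcs! i j)
  U^-column (suc n) i j = trans (sumFin-cong nArcs λ k → *-congˡ (U i k) (U^-column n k j)) (U-apply (evolve (arc j) n) i)

  -- Restricted to arcs, because elsewhere `evolve` says nothing about `U`.
  Recurrent : ℕ → Set
  Recurrent n = ∀ a b u v → Adj a b → Adj u v → evolve (a , b) n (u , v) ≡ ⟦ (u , v) ≟P (a , b) ⟧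

  periodic⇒recurrent : Periodic → ∃ λ n → 1 ≤ n × Recurrent n
  periodic⇒recurrent (n , 1≤n , U^n≡I) = n , 1≤n , lemma
    where
    arc-surjective : ∀ {u v} → Adj u v → ∃ λ i → arc i ≡ (u , v)
    arc-surjective u~v = Any.index (∈-arcs u~v) , sym (lookup-index (∈-arcs u~v))
    lemma : Recurrent n
    lemma a b u v a~b u~v with arc-surjective u~v | arc-surjective a~b
    ... | i , refl | j , refl = trans (sym (U^-column n i j)) (trans (U^n≡I i j) (U^-column 0 i j))

  recurrent⇒periodic : ∀ {n} → 1 ≤ n → Recurrent n → Periodic
  recurrent⇒periodic {n} 1≤n rec = n , 1≤n , λ i j →
    trans (U^-column n i j) (trans (rec _ _ _ _ (arc-adj j) (arc-adj i)) (sym (U^-column 0 i j)))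

  inflow-cong : ∀ {X Y} → (∀ {u v} → Adj u v → X (u , v) ≡ Y (u , v)) → ∀ u → inflow X u ≡ inflow Y u
  inflow-cong {X} {Y} X≗Y u = ∑-cong vertices term
    where
    term : ∀ w → ⟦ adj? u w ⟧ * X (w , u) ≡ ⟦ adj? u w ⟧ * Y (w , u)
    term w with adj? u w
    ... | yes u~w = *-congˡ 1ℚ (X≗Y (Adj-sym u~w))
    ... | no  _   = trans (*-zeroˡ (X (w , u))) (sym (*-zeroˡ (Y (w , u))))

  -- Reversing the arcs into `u` gives the arcs out of `u`, which is where the outflow comes from.
  inflow-step : ∀ X u → inflow (step X) u ≡ c * adjacency (inflow X) u - outflow X u
  inflow-step X u = trans (∑-cong vertices λ w → distribute ⟦ adj? u w ⟧ c (inflow X w) (X (u , w)))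
                          (∑-linear vertices c _ _)
    where
    distribute : ∀ x c y z → x * (c * y - z) ≡ c * (x * y) - x * z
    distribute = solve 4 (λ x c y z → x :* (c :* y :- z) := c :* (x :* y) :- x :* z) refl

  -- The `k` arcs leaving `u` each receive `c * inflow X u`, in total twice the inflow since c k =
  -- 2, and the reversed arcs subtract it once. This eliminates the outflow from `inflow-step`.
  outflow-step : ∀ X u → outflow (step X) u ≡ inflow X u
  outflow-step X u = begin
    outflow (step X) u
      ≡⟨ ∑-cong vertices (λ w → distribute ⟦ adj? u w ⟧ (c * inflow X u) (X (w , u))) ⟩
    ∑[ w ∈ vertices ] ((c * inflow X u) * (⟦ adj? u w ⟧ * 1ℚ) - ⟦ adj? u w ⟧ * X (w , u))
      ≡⟨ ∑-linear vertices (c * inflow X u) _ _ ⟩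
    (c * inflow X u) * adjacency (λ _ → 1ℚ) u - inflow X u
      ≡⟨ cong (λ z → (c * inflow X u) * z - inflow X u) (adjacency-1 u) ⟩
    (c * inflow X u) * k - inflow X u
      ≡⟨ solve 3 (λ c x k → (c :* x) :* k :- x := (c :* k) :* x :- x) refl c (inflow X u) k ⟩
    (c * k) * inflow X u - inflow X u
      ≡⟨ cong (λ z → z * inflow X u - inflow X u) c*k≡2 ⟩
    (1ℚ + 1ℚ) * inflow X u - inflow X u
      ≡⟨ solve 1 (λ x → con (1ℚ + 1ℚ) :* x :- x := x) refl (inflow X u) ⟩
    inflow X u ∎
    where
    open ≡-Reasoning
    distribute : ∀ x y z → x * (y - z) ≡ y * (x * 1ℚ) - x * z
    distribute = solve 3 (λ x y z → x :* (y :- z) := y :* (x :* con 1ℚ) :- x :* z) refl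

  -- The sequence P for the column e.  It starts with an outflow because outflow (step X) is inflow X.
  flow : Pair → ℕ → V → ℚ
  flow e zero    = outflow (evolve e 0)
  flow e (suc n) = inflow (evolve e n)

  outflow-evolve : ∀ e n u → outflow (evolve e n) u ≡ flow e n u
  outflow-evolve e zero    u = refl
  outflow-evolve e (suc n) u = outflow-step (evolve e n) u

  flow-recurrence : ∀ e n u → flow e (2 ℕ.+ n) u ≡ c * adjacency (flow e (1 ℕ.+ n)) u - flow e n u
  flow-recurrence e n u = trans (inflow-step (evolve e n) u)
    (cong (λ z → c * adjacency (flow e (1 ℕ.+ n)) u - z) (outflow-evolve e n u))

  ⟦⟧-pair : ∀ u v a b → ⟦ (u , v) ≟P (a , b) ⟧ ≡ ⟦ u ≟V a ⟧ * ⟦ v ≟V b ⟧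
  ⟦⟧-pair u v a b = ⟦⟧-× (u ≟V a) (v ≟V b) ((u , v) ≟P (a , b)) (λ { refl → refl , refl }) (λ { (refl , refl) → refl })

  ⟦⟧-absorb : ∀ {a b} → Adj a b → ∀ u → ⟦ adj? u b ⟧ * ⟦ u ≟V a ⟧ ≡ ⟦ u ≟V a ⟧
  ⟦⟧-absorb {a} {b} a~b u with u ≟V a
  ... | yes refl = trans (*-identityʳ _) (⟦⟧-true (adj? u b) a~b)
  ... | no  _    = *-zeroʳ ⟦ adj? u b ⟧

  flow-0 : ∀ {a b} → Adj a b → ∀ u → flow (a , b) 0 u ≡ ⟦ u ≟V a ⟧
  flow-0 {a} {b} a~b u = begin
    ∑[ w ∈ vertices ] (⟦ adj? u w ⟧ * ⟦ (u , w) ≟P (a , b) ⟧)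
      ≡⟨ ∑-cong vertices (λ w → trans (*-congˡ ⟦ adj? u w ⟧ (⟦⟧-pair u w a b)) (rotate ⟦ adj? u w ⟧ ⟦ u ≟V a ⟧ ⟦ w ≟V b ⟧)) ⟩
    ∑[ w ∈ vertices ] (⟦ w ≟V b ⟧ * (⟦ adj? u w ⟧ * ⟦ u ≟V a ⟧))
      ≡⟨ ∑-sift _≟V_ _ vertices! (∈-vertices b) ⟩
    ⟦ adj? u b ⟧ * ⟦ u ≟V a ⟧
      ≡⟨ ⟦⟧-absorb a~b u ⟩
    ⟦ u ≟V a ⟧ ∎
    where
    open ≡-Reasoning
    rotate : ∀ x y z → x * (y * z) ≡ z * (x * y)
    rotate = solve 3 (λ x y z → x :* (y :* z) := z :* (x :* y)) refl

  flow-1 : ∀ {a b} → Adj a b → ∀ u → flow (a , b) 1 u ≡ ⟦ u ≟V b ⟧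
  flow-1 {a} {b} a~b u = begin
    ∑[ w ∈ vertices ] (⟦ adj? u w ⟧ * ⟦ (w , u) ≟P (a , b) ⟧)
      ≡⟨ ∑-cong vertices (λ w → trans (*-congˡ ⟦ adj? u w ⟧ (⟦⟧-pair w u a b)) (exchange ⟦ adj? u w ⟧ ⟦ w ≟V a ⟧ ⟦ u ≟V b ⟧)) ⟩
    ∑[ w ∈ vertices ] (⟦ w ≟V a ⟧ * (⟦ adj? u w ⟧ * ⟦ u ≟V b ⟧))
      ≡⟨ ∑-sift _≟V_ _ vertices! (∈-vertices a) ⟩
    ⟦ adj? u a ⟧ * ⟦ u ≟V b ⟧
      ≡⟨ ⟦⟧-absorb (Adj-sym a~b) u ⟩
    ⟦ u ≟V b ⟧ ∎
    where open ≡-Reasoning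

  -- Reversing twice restores `(u , v)`, so two steps change the value only by flows. An even power
  -- of `U` therefore telescopes.
  evolve-2+ : ∀ e n u v → evolve e (2 ℕ.+ n) (u , v) ≡
              evolve e n (u , v) + c * (flow e (2 ℕ.+ n) u - flow e (1 ℕ.+ n) v)
  evolve-2+ e n u v = solve 4 (λ c x y z → c :* x :- (c :* y :- z) := z :+ c :* (x :- y)) refl
    c (flow e (2 ℕ.+ n) u) (flow e (1 ℕ.+ n) v) (evolve e n (u , v))

  -- Self-adjointness; it moves the adjacency operator from a flow onto an eigenvector.
  adjacency-symmetric : ∀ f g → ∑[ u ∈ vertices ] (f u * adjacency g u) ≡ ∑[ u ∈ vertices ] (adjacency f u * g u)
  adjacency-symmetric f g = begin
    ∑[ u ∈ vertices ] (f u * adjacency g u)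
      ≡⟨ ∑-cong vertices (λ u → sym (∑-*ˡ vertices (f u) _)) ⟩
    ∑[ u ∈ vertices ] ∑[ w ∈ vertices ] (f u * (⟦ adj? u w ⟧ * g w))
      ≡⟨ ∑-swap vertices vertices _ ⟩
    ∑[ w ∈ vertices ] ∑[ u ∈ vertices ] (f u * (⟦ adj? u w ⟧ * g w))
      ≡⟨ ∑-cong vertices (λ w → trans (∑-cong vertices (term w)) (∑-*ʳ vertices _ (g w))) ⟩
    ∑[ u ∈ vertices ] (adjacency f u * g u) ∎
    where
    open ≡-Reasoning
    term : ∀ w u → f u * (⟦ adj? u w ⟧ * g w) ≡ (⟦ adj? w u ⟧ * f u) * g w
    term w u = trans (cong (λ z → f u * (z * g w)) (⟦⟧-cong (adj? u w) (adj? w u) Adj-sym Adj-sym))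
      (solve 3 (λ x y z → y :* (x :* z) := (x :* y) :* z) refl ⟦ adj? w u ⟧ (f u) (g w))

-- The Hamming graph and its adjacency operator

concatMap≡cartesianProductWith : ∀ {A B C : Set} (f : A → B → C) xs ys →
  concatMap (λ x → map (f x) ys) xs ≡ cartesianProductWith f xs ys
concatMap≡cartesianProductWith f []       ys = refl
concatMap≡cartesianProductWith f (x ∷ xs) ys = cong (map (f x) ys ++_) (concatMap≡cartesianProductWith f xs ys)

allVecs! : ∀ q d → Unique (allVecs q d)
allVecs! q zero    = [] ∷ []
allVecs! q (suc d) = subst Unique (sym (concatMap≡cartesianProductWith _∷_ (allFin q) (allVecs q d)))
  (Unique.cartesianProductWith⁺ _∷_ Vec.∷-injective (Unique.allFin⁺ q) (allVecs! q d))

∈-allVecs : ∀ {q d} (x : Vec (Fin q) d) → x ∈ allVecs q d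
∈-allVecs []                   = here refl
∈-allVecs {q} {suc d} (a ∷ x) = subst (a ∷ x ∈_) (sym (concatMap≡cartesianProductWith _∷_ (allFin q) (allVecs q d)))
  (∈-cartesianProductWith⁺ _∷_ (∈-allFin a) (∈-allVecs x))

hdist-sym : ∀ {q d} (x y : Vec (Fin q) d) → hdist x y ≡ hdist y x
hdist-sym []       []       = refl
hdist-sym (a ∷ x) (b ∷ y) with a Fin.≟ b | b Fin.≟ a
... | yes _    | yes _   = hdist-sym x y
... | yes refl | no  b≢b = contradiction refl b≢b
... | no  a≢a  | yes refl = contradiction refl a≢a
... | no  _    | no  _   = cong suc (hdist-sym x y)

hdist-refl : ∀ {q d} (x : Vec (Fin q) d) → hdist x x ≡ 0
hdist-refl []      = refl
hdist-refl (a ∷ x) rewrite dec-true (a Fin.≟ a) refl = hdist-refl x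

hdist≡0⇒≡ : ∀ {q d} (x y : Vec (Fin q) d) → hdist x y ≡ 0 → x ≡ y
hdist≡0⇒≡ []       []       _ = refl
hdist≡0⇒≡ (a ∷ x) (b ∷ y) h≡0 with a Fin.≟ b
... | yes refl = cong (a ∷_) (hdist≡0⇒≡ x y h≡0)
hdist≡0⇒≡ (a ∷ x) (b ∷ y) () | no _

hdist≤d : ∀ {q d} (x y : Vec (Fin q) d) → hdist x y ≤ d
hdist≤d []       []       = ℕ.z≤n
hdist≤d (a ∷ x) (b ∷ y) with does (a Fin.≟ b)
... | true  = ℕ.m≤n⇒m≤1+n (hdist≤d x y)
... | false = ℕ.s≤s (hdist≤d x y)

_≟ⱽ_ : ∀ {q d} → DecidableEquality (Vec (Fin q) d)
_≟ⱽ_ = Vec.≡-dec Fin._≟_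

-- Unfolds to `adjacency` of the Hamming graph. It comes first because the degree, a parameter of
-- `RegularGraph`, is computed with it.
𝐀 : ∀ {q} d → (Vec (Fin q) d → ℚ) → Vec (Fin q) d → ℚ
𝐀 {q} d f u = ∑[ w ∈ allVecs q d ] (⟦ hdist u w ℕ.≟ 1 ⟧ * f w)

-- The graph is the Cartesian product of a complete graph on `q` vertices and the Hamming graph of
-- dimension `d`: either the tail moves or the head does. The difference in parentheses is the
-- adjacency operator of the complete graph.
𝐀-∷ : ∀ {q} d (f : Vec (Fin q) (suc d) → ℚ) b y →
      𝐀 (suc d) f (b ∷ y) ≡ 𝐀 d (λ x → f (b ∷ x)) y + (∑[ a ∈ allFin q ] f (a ∷ y) - f (b ∷ y))
𝐀-∷ {q} d f b y = begin
  𝐀 (suc d) f (b ∷ y)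
    ≡⟨ ∑-concatMap (λ a → map (a ∷_) (allVecs q d)) (allFin q) _ ⟩
  ∑[ a ∈ allFin q ] ∑ (map (a ∷_) (allVecs q d)) (λ w → ⟦ hdist (b ∷ y) w ℕ.≟ 1 ⟧ * f w)
    ≡⟨ ∑-cong (allFin q) (λ a → begin
         ∑ (map (a ∷_) (allVecs q d)) (λ w → ⟦ hdist (b ∷ y) w ℕ.≟ 1 ⟧ * f w)
           ≡⟨ ∑-map (a ∷_) (allVecs q d) _ ⟩
         ∑[ x ∈ allVecs q d ] (⟦ hdist (b ∷ y) (a ∷ x) ℕ.≟ 1 ⟧ * f (a ∷ x))
           ≡⟨ ∑-cong (allVecs q d) (split a) ⟩
         ∑[ x ∈ allVecs q d ] (⟦ a Fin.≟ b ⟧ * P a x + (1ℚ - ⟦ a Fin.≟ b ⟧) * Q a x)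
           ≡⟨ ∑-+ (allVecs q d) _ _ ⟩
         ∑[ x ∈ allVecs q d ] (⟦ a Fin.≟ b ⟧ * P a x) + ∑[ x ∈ allVecs q d ] ((1ℚ - ⟦ a Fin.≟ b ⟧) * Q a x)
           ≡⟨ cong₂ _+_ (∑-*ˡ (allVecs q d) ⟦ a Fin.≟ b ⟧ (P a)) (∑-*ˡ (allVecs q d) (1ℚ - ⟦ a Fin.≟ b ⟧) (Q a)) ⟩
         ⟦ a Fin.≟ b ⟧ * 𝐀 d (λ x → f (a ∷ x)) y + (1ℚ - ⟦ a Fin.≟ b ⟧) * ∑ (allVecs q d) (Q a)
           ≡⟨ cong (λ z → ⟦ a Fin.≟ b ⟧ * 𝐀 d (λ x → f (a ∷ x)) y + (1ℚ - ⟦ a Fin.≟ b ⟧) * z)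
                (∑-sift _≟ⱽ_ (λ x → f (a ∷ x)) (allVecs! q d) (∈-allVecs y)) ⟩
         ⟦ a Fin.≟ b ⟧ * 𝐀 d (λ x → f (a ∷ x)) y + (1ℚ - ⟦ a Fin.≟ b ⟧) * f (a ∷ y)
           -- Rearranged so that the bracket multiplies a single term, which the sum over `a` can
           -- sift.
           ≡⟨ solve 3 (λ i s t → i :* s :+ (con 1ℚ :- i) :* t := i :* (s :- t) :+ t) refl
                ⟦ a Fin.≟ b ⟧ (𝐀 d (λ x → f (a ∷ x)) y) (f (a ∷ y)) ⟩
         ⟦ a Fin.≟ b ⟧ * (𝐀 d (λ x → f (a ∷ x)) y - f (a ∷ y)) + f (a ∷ y) ∎) ⟩
  ∑[ a ∈ allFin q ] (⟦ a Fin.≟ b ⟧ * (𝐀 d (λ x → f (a ∷ x)) y - f (a ∷ y)) + f (a ∷ y))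
    ≡⟨ ∑-+ (allFin q) _ _ ⟩
  ∑[ a ∈ allFin q ] (⟦ a Fin.≟ b ⟧ * (𝐀 d (λ x → f (a ∷ x)) y - f (a ∷ y))) + ∑[ a ∈ allFin q ] f (a ∷ y)
    ≡⟨ cong (_+ ∑[ a ∈ allFin q ] f (a ∷ y)) (∑-sift Fin._≟_ (λ a → 𝐀 d (λ x → f (a ∷ x)) y - f (a ∷ y)) (Unique.allFin⁺ q) (∈-allFin b)) ⟩
  (𝐀 d (λ x → f (b ∷ x)) y - f (b ∷ y)) + ∑[ a ∈ allFin q ] f (a ∷ y)
    ≡⟨ solve 3 (λ s t r → (s :- t) :+ r := s :+ (r :- t)) refl (𝐀 d (λ x → f (b ∷ x)) y) (f (b ∷ y)) _ ⟩
  𝐀 d (λ x → f (b ∷ x)) y + (∑[ a ∈ allFin q ] f (a ∷ y) - f (b ∷ y)) ∎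
  where
  open ≡-Reasoning
  P Q : Fin q → Vec (Fin q) d → ℚ
  P a x = ⟦ hdist y x ℕ.≟ 1 ⟧ * f (a ∷ x)
  Q a x = ⟦ x ≟ⱽ y ⟧ * f (a ∷ x)
  -- Different heads already account for distance 1, so adjacency then forces equal tails.
  split : ∀ a x → ⟦ hdist (b ∷ y) (a ∷ x) ℕ.≟ 1 ⟧ * f (a ∷ x) ≡ ⟦ a Fin.≟ b ⟧ * P a x + (1ℚ - ⟦ a Fin.≟ b ⟧) * Q a x
  split a x with a Fin.≟ b
  ... | yes refl rewrite dec-true (a Fin.≟ a) refl =
    solve 2 (λ p q → p := con 1ℚ :* p :+ (con 1ℚ :- con 1ℚ) :* q) refl (P a x) (Q a x)
  ... | no a≢b rewrite dec-false (b Fin.≟ a) (a≢b ∘ sym)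
                     | ⟦⟧-cong (suc (hdist y x) ℕ.≟ 1) (x ≟ⱽ y)
                         (λ e → sym (hdist≡0⇒≡ y x (ℕ.suc-injective e))) (λ { refl → cong suc (hdist-refl x) }) =
    solve 2 (λ p q → q := con 0ℚ :* p :+ (con 1ℚ :- con 0ℚ) :* q) refl (P a x) (Q a x)

∑-allFin-const : ∀ q x → ∑[ a ∈ allFin q ] x ≡ ℕ→ℚ q * x
∑-allFin-const q x = begin
  ∑[ a ∈ allFin q ] x           ≡⟨ ∑-cong (allFin q) (λ _ → sym (*-identityˡ x)) ⟩
  ∑[ a ∈ allFin q ] (1ℚ * x)    ≡⟨ ∑-*ʳ (allFin q) _ x ⟩
  ∑ (allFin q) (λ _ → 1ℚ) * x   ≡⟨ *-congʳ x (∑-1 (allFin q)) ⟩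
  ℕ→ℚ (length (allFin q)) * x   ≡⟨ cong (λ n → ℕ→ℚ n * x) (length-tabulate {n = q} id) ⟩
  ℕ→ℚ q * x                     ∎
  where open ≡-Reasoning

𝐀-const : ∀ {q'} d x (u : Vec (Fin (suc q')) d) → 𝐀 d (λ _ → x) u ≡ ℕ→ℚ (d ℕ.* q') * x
𝐀-const {q'} zero    x [] = trans (+-identityʳ _) refl
𝐀-const {q'} (suc d) x (a ∷ u) = begin
  𝐀 (suc d) (λ _ → x) (a ∷ u)
    ≡⟨ 𝐀-∷ d (λ _ → x) a u ⟩
  𝐀 d (λ _ → x) u + (∑[ a ∈ allFin (suc q') ] x - x)
    ≡⟨ cong₂ (λ s t → s + (t - x)) (𝐀-const d x u) (trans (∑-allFin-const (suc q') x) (*-congʳ x (ℕ→ℚ-suc q'))) ⟩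
  ℕ→ℚ (d ℕ.* q') * x + ((1ℚ + ℕ→ℚ q') * x - x)
    ≡⟨ solve 3 (λ m n x → m :* x :+ ((con 1ℚ :+ n) :* x :- x) := (n :+ m) :* x) refl (ℕ→ℚ (d ℕ.* q')) (ℕ→ℚ q') x ⟩
  (ℕ→ℚ q' + ℕ→ℚ (d ℕ.* q')) * x
    ≡⟨ *-congʳ x (ι-+ (ℤ.+ q') (ℤ.+ (d ℕ.* q'))) ⟨
  ℕ→ℚ (suc d ℕ.* q') * x ∎
  where open ≡-Reasoning

-- The degree is the value of `𝐀` on the constant 1, brought back from `ℚ` to `ℕ` by injectivity.
Hamming-deg : ∀ d q' v → Grover.deg (Hamming d (suc q')) v ≡ d ℕ.* q'
Hamming-deg d q' v = ℤ.+-injective (ι-injective (begin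
  ℕ→ℚ (length (filter (λ w → hdist v w ℕ.≟ 1) (allVecs (suc q') d)))
    ≡⟨ ∑-1 (filter (λ w → hdist v w ℕ.≟ 1) (allVecs (suc q') d)) ⟨
  ∑ (filter (λ w → hdist v w ℕ.≟ 1) (allVecs (suc q') d)) (λ _ → 1ℚ)
    ≡⟨ ∑-filter (λ w → hdist v w ℕ.≟ 1) (allVecs (suc q') d) _ ⟩
  𝐀 d (λ _ → 1ℚ) v
    ≡⟨ 𝐀-const d 1ℚ v ⟩
  ℕ→ℚ (d ℕ.* q') * 1ℚ
    ≡⟨ *-identityʳ _ ⟩
  ℕ→ℚ (d ℕ.* q') ∎))
  where open ≡-Reasoning

-- Here e = d - 1 and p = q - 2, so that the degree d (q - 1) is a successor.
module HammingGraph (e p : ℕ) = RegularGraph (Hamming (suc e) (suc (suc p)))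
  (allVecs! _ _) ∈-allVecs (λ {x} {y} x~y → trans (hdist-sym y x) x~y)
  (p ℕ.+ e ℕ.* suc p) (Hamming-deg (suc e) (suc p))

-- With q' = q - 1: a vertex at distance j from b has j neighbours at distance j - 1, j (q - 2) at
-- distance j and (d - j) (q - 1) at distance j + 1.  The junk value pred 0 = 0 has coefficient 0.
radial : (q' : ℕ) (d : ℕ) → (ℕ → ℚ) → ℕ → ℚ
radial q' d f j = ℕ→ℚ j * f (ℕ.pred j) + ℕ→ℚ j * (ℕ→ℚ q' - 1ℚ) * f j + (ℕ→ℚ d - ℕ→ℚ j) * ℕ→ℚ q' * f (suc j)

-- Induction on `d` by `𝐀-∷`. The tail contributes `radial` of `f` shifted by the head's share `ε a`
-- of the distance; in the row of heads one vertex lies at distance `h` and the other `q'` at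
-- distance `suc h`.
𝐀-radial : ∀ {q'} d (f : ℕ → ℚ) (b u : Vec (Fin (suc q')) d) →
           𝐀 d (λ x → f (hdist x b)) u ≡ radial q' d f (hdist u b)
𝐀-radial {q'} zero    f [] [] =
  solve 4 (λ x y z w → con 0ℚ :* x :+ con 0ℚ := con 0ℚ :* x :+ con 0ℚ :* w :* x :+ con 0ℚ :* z :* y) refl (f 0) (f 1) (ℕ→ℚ q') (ℕ→ℚ q' - 1ℚ)
𝐀-radial {q'} (suc d) f (b ∷ y) (a ∷ x) = begin
  𝐀 (suc d) (λ w → f (hdist w (b ∷ y))) (a ∷ x)
    ≡⟨ 𝐀-∷ d (λ w → f (hdist w (b ∷ y))) a x ⟩
  𝐀 d (λ w → f (ε a ℕ.+ hdist w y)) x + (∑[ a ∈ allFin (suc q') ] f (ε a ℕ.+ h) - f (ε a ℕ.+ h))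
    ≡⟨ cong₂ (λ s t → s + (t - f (ε a ℕ.+ h))) (𝐀-radial d (λ j → f (ε a ℕ.+ j)) y x) row-sum ⟩
  radial q' d (λ j → f (ε a ℕ.+ j)) h + ((f h + ℕ→ℚ q' * f (suc h)) - f (ε a ℕ.+ h))
    ≡⟨ combine (does (a Fin.≟ b)) ⟩
  radial q' (suc d) f (ε a ℕ.+ h) ∎
  where
  open ≡-Reasoning
  h = hdist x y
  ε : Fin (suc q') → ℕ
  ε a = if does (a Fin.≟ b) then 0 else 1
  row-sum : ∑[ a ∈ allFin (suc q') ] f (ε a ℕ.+ h) ≡ f h + ℕ→ℚ q' * f (suc h)
  row-sum = begin
    ∑[ a ∈ allFin (suc q') ] f (ε a ℕ.+ h)
      ≡⟨ ∑-cong (allFin (suc q')) term ⟩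
    ∑[ a ∈ allFin (suc q') ] (⟦ a Fin.≟ b ⟧ * (f h - f (suc h)) + f (suc h))
      ≡⟨ ∑-+ (allFin (suc q')) (λ a → ⟦ a Fin.≟ b ⟧ * (f h - f (suc h))) (λ _ → f (suc h)) ⟩
    ∑[ a ∈ allFin (suc q') ] (⟦ a Fin.≟ b ⟧ * (f h - f (suc h))) + ∑[ a ∈ allFin (suc q') ] f (suc h)
      ≡⟨ cong₂ _+_ (∑-sift Fin._≟_ (λ _ → f h - f (suc h)) (Unique.allFin⁺ (suc q')) (∈-allFin b))
                   (trans (∑-allFin-const (suc q') (f (suc h))) (*-congʳ (f (suc h)) (ℕ→ℚ-suc q'))) ⟩
    (f h - f (suc h)) + (1ℚ + ℕ→ℚ q') * f (suc h)
      ≡⟨ solve 3 (λ s t r → (s :- t) :+ (con 1ℚ :+ r) :* t := s :+ r :* t) refl (f h) (f (suc h)) (ℕ→ℚ q') ⟩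
    f h + ℕ→ℚ q' * f (suc h) ∎
    where
    term : ∀ a → f (ε a ℕ.+ h) ≡ ⟦ a Fin.≟ b ⟧ * (f h - f (suc h)) + f (suc h)
    term a with does (a Fin.≟ b)
    ... | true  = solve 2 (λ s t → s := con 1ℚ :* (s :- t) :+ t) refl (f h) (f (suc h))
    ... | false = solve 2 (λ s t → t := con 0ℚ :* (s :- t) :+ t) refl (f h) (f (suc h))
  -- Different heads shift `f` by one, and `suc (pred h)` is `h` except at `h = 0`, where the
  -- coefficient vanishes.
  suc-pred : ∀ j → ℕ→ℚ j * f (suc (ℕ.pred j)) ≡ ℕ→ℚ j * f j
  suc-pred zero    = trans (*-zeroˡ (f 1)) (sym (*-zeroˡ (f 0)))
  suc-pred (suc j) = refl
  combine : ∀ c → let i = if c then 0 else 1 in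
            radial q' d (λ j → f (i ℕ.+ j)) h + ((f h + ℕ→ℚ q' * f (suc h)) - f (i ℕ.+ h)) ≡ radial q' (suc d) f (i ℕ.+ h)
  combine true  rewrite ℕ→ℚ-suc d =
    solve 6 (λ s t r H D z → (H :* z :+ H :* (r :- con 1ℚ) :* s :+ (D :- H) :* r :* t) :+ ((s :+ r :* t) :- s) :=
                           H :* z :+ H :* (r :- con 1ℚ) :* s :+ (con 1ℚ :+ D :- H) :* r :* t) refl
      (f h) (f (suc h)) (ℕ→ℚ q') (ℕ→ℚ h) (ℕ→ℚ d) (f (ℕ.pred h))
  combine false rewrite ℕ→ℚ-suc d | ℕ→ℚ-suc h | suc-pred h =
    solve 6 (λ s t r H D z → (H :* s :+ H :* (r :- con 1ℚ) :* t :+ (D :- H) :* r :* z) :+ ((s :+ r :* t) :- t) :=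
                           (con 1ℚ :+ H) :* s :+ (con 1ℚ :+ H) :* (r :- con 1ℚ) :* t :+ (con 1ℚ :+ D :- (con 1ℚ :+ H)) :* r :* z) refl
      (f h) (f (suc h)) (ℕ→ℚ q') (ℕ→ℚ h) (ℕ→ℚ d) (f (suc (suc h)))

-- Integrality by the rational root theorem

coprime∣^⇒∣1 : ∀ {r P} n → ℤ.Coprime r P → r ℤ.∣ P ℤ.^ n → r ℤ.∣ ℤ.1ℤ
coprime∣^⇒∣1 zero    cop r∣1  = r∣1
coprime∣^⇒∣1 {r} {P} (suc n) cop r∣P^ = coprime∣^⇒∣1 {r} {P} n cop (ℤ.coprime-divisor r P (P ℤ.^ n) cop r∣P^)

*-↧ : ∀ s → s * ι (↧ s) ≡ ι (↥ s)
*-↧ s@(mkℚ P d-1 _) = trans (*-congʳ (ι (ℤ.+ suc d-1)) (sym (↥p/↧p≡p s))) (/-* P d-1)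

↥-↧-coprime : ∀ s → ℤ.Coprime (↥ s) (↧ s)
↥-↧-coprime (mkℚ P d-1 cop) = recompute (ℤ.coprime? P (ℤ.+ suc d-1)) cop

-- y (suc n) is a monic polynomial in s of degree n with integer coefficients, so this is an
-- instance of the rational root theorem.
module IntegerRecurrence (s : ℚ) (y : ℕ → ℚ) (y₀ : y 0 ≡ - 1ℚ) (y₁ : y 1 ≡ 1ℚ)
         (y-rec : ∀ n → y (2 ℕ.+ n) ≡ s * y (1 ℕ.+ n) - y n) where

  private
    P r : ℤ
    P = ↥ s
    r = ↧ s

  -- With s = P / r, each step multiplies the leading term by `P`, while the term two indices back
  -- keeps a spare factor `r * r`; so all but the power of `P` stays divisible by `r`.
  clear-denominators : ∀ n → ∃ λ m → ι (r ℤ.^ n) * y (suc n) ≡ ι (P ℤ.^ n ℤ.+ r ℤ.* m)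
  clear-denominators zero = ℤ.0ℤ , (begin
    1ℚ * y 1 ≡⟨ *-identityˡ (y 1) ⟩
    y 1 ≡⟨ y₁ ⟩
    ι (ℤ.+ 1) ≡⟨ cong ι (cong (ℤ._+_ ℤ.1ℤ) (ℤ.*-zeroʳ r)) ⟨
    ι (ℤ.+ 1 ℤ.+ r ℤ.* ℤ.0ℤ) ∎)
    where open ≡-Reasoning
  -- `y 0` lies outside the claim, so y 2 = s + 1 is a second base case; its constant term 1 is the
  -- witness.
  clear-denominators (suc zero) = ℤ.1ℤ , (begin
    ι (r ℤ.* ℤ.1ℤ) * y 2                 ≡⟨ cong₂ (λ x z → ι x * z) (ℤ.*-identityʳ r) (y-rec 0) ⟩
    ι r * (s * y 1 - y 0)                ≡⟨ cong₂ (λ x z → ι r * (s * x - z)) y₁ y₀ ⟩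
    ι r * (s * 1ℚ - - 1ℚ)                ≡⟨ solve 2 (λ r s → r :* (s :* con 1ℚ :- con (- 1ℚ)) := s :* r :+ r) refl (ι r) s ⟩
    s * ι r + ι r                        ≡⟨ cong (_+ ι r) (*-↧ s) ⟩
    ι P + ι r                            ≡⟨ ι-+ P r ⟨
    ι (P ℤ.+ r)                          ≡⟨ cong₂ (λ x z → ι (x ℤ.+ z)) (ℤ.*-identityʳ P) (ℤ.*-identityʳ r) ⟨
    ι (P ℤ.* ℤ.1ℤ ℤ.+ r ℤ.* ℤ.1ℤ)        ∎)
    where open ≡-Reasoning
  clear-denominators (suc (suc n)) with clear-denominators (suc n) | clear-denominators n
  -- The witness collects the multiples of `r` in P E₁ - r r E₀.
  ... | m₁ , eq₁ | m₀ , eq₀ = P ℤ.* m₁ ℤ.+ ℤ.- (r ℤ.* (P ℤ.^ n ℤ.+ r ℤ.* m₀)) , (begin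
    ι (r ℤ.* (r ℤ.* R)) * y (3 ℕ.+ n)
      ≡⟨ cong₂ _*_ (trans (ι-* r (r ℤ.* R)) (*-congˡ (ι r) (ι-* r R))) (y-rec (suc n)) ⟩
    (ι r * (ι r * ι R)) * (s * y (2 ℕ.+ n) - y (1 ℕ.+ n))
      ≡⟨ solve 5 (λ r R s x z → (r :* (r :* R)) :* (s :* x :- z) := (s :* r) :* ((r :* R) :* x) :+ (:- (r :* r)) :* (R :* z))
           refl (ι r) (ι R) s (y (2 ℕ.+ n)) (y (1 ℕ.+ n)) ⟩
    (s * ι r) * ((ι r * ι R) * y (2 ℕ.+ n)) + (- (ι r * ι r)) * (ι R * y (1 ℕ.+ n))
      ≡⟨ cong₂ _+_ (cong₂ _*_ (*-↧ s) (trans (*-congʳ (y (2 ℕ.+ n)) (sym (ι-* r R))) eq₁)) (*-congˡ (- (ι r * ι r)) eq₀) ⟩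
    ι P * ι E₁ + (- (ι r * ι r)) * ι E₀
      ≡⟨ cong₂ _+_ (ι-* P E₁) (trans (ι-* (ℤ.- (r ℤ.* r)) E₀) (*-congʳ (ι E₀) (trans (ι-neg (r ℤ.* r)) (cong -_ (ι-* r r))))) ⟨
    ι (P ℤ.* E₁) + ι (ℤ.- (r ℤ.* r) ℤ.* E₀)
      ≡⟨ ι-+ (P ℤ.* E₁) (ℤ.- (r ℤ.* r) ℤ.* E₀) ⟨
    ι (P ℤ.* E₁ ℤ.+ ℤ.- (r ℤ.* r) ℤ.* E₀)
      ≡⟨ cong ι (regroup P r (P ℤ.^ n) m₀ m₁) ⟩
    ι (P ℤ.* (P ℤ.* (P ℤ.^ n)) ℤ.+ r ℤ.* (P ℤ.* m₁ ℤ.+ ℤ.- (r ℤ.* E₀)))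
      ∎)
    where
    open ≡-Reasoning
    R E₁ E₀ : ℤ
    R = r ℤ.^ n
    E₁ = P ℤ.* (P ℤ.^ n) ℤ.+ r ℤ.* m₁
    E₀ = P ℤ.^ n ℤ.+ r ℤ.* m₀
    regroup : ∀ P r X m₀ m₁ → P ℤ.* (P ℤ.* X ℤ.+ r ℤ.* m₁) ℤ.+ ℤ.- (r ℤ.* r) ℤ.* (X ℤ.+ r ℤ.* m₀)
              ≡ P ℤ.* (P ℤ.* X) ℤ.+ r ℤ.* (P ℤ.* m₁ ℤ.+ ℤ.- (r ℤ.* (X ℤ.+ r ℤ.* m₀)))
    regroup = solve-∀

  integral : ∀ {n} → 1 ≤ n → y (suc n) ≡ 1ℚ → ∃ λ m → s ≡ ι m
  integral {suc n} _ y≡1 with clear-denominators (suc n)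
  ... | m , eq = P , (begin
    s           ≡⟨ *-identityʳ s ⟨
    s * ι ℤ.1ℤ  ≡⟨ cong (λ z → s * ι z) r≡1 ⟨
    s * ι r     ≡⟨ *-↧ s ⟩
    ι P         ∎)
    where
    open ≡-Reasoning
    r^≡ : r ℤ.^ suc n ≡ P ℤ.^ suc n ℤ.+ r ℤ.* m
    r^≡ = ι-injective (trans (sym (trans (*-congˡ (ι (r ℤ.^ suc n)) y≡1) (*-identityʳ _))) eq)
    -- The exponent is positive, so `r` divides the left side of `r^≡`, hence also the power of `P`.
    r∣P^ : r Signed.∣ P ℤ.^ suc n
    r∣P^ = Signed.∣m+n∣n⇒∣m {m = P ℤ.^ suc n} {n = r ℤ.* m}
      (subst (r Signed.∣_) r^≡ (Signed.∣m⇒∣m*n (r ℤ.^ n) Signed.∣-refl)) (Signed.∣m⇒∣m*n m Signed.∣-refl)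
    r≡1 : r ≡ ℤ.1ℤ
    r≡1 = cong ℤ.+_ (ℕ.∣1⇒≡1 (coprime∣^⇒∣1 {r} {P} (suc n) (ℤ.sym {P} {r} (↥-↧-coprime s)) (Signed.∣⇒∣ᵤ r∣P^)))

-- Necessity: the second largest eigenvalue

module FirstCoordinate (e p : ℕ) where
  open HammingGraph e p
  private
    q' q N : ℕ
    q' = suc p
    q  = suc q'
    N  = suc e ℕ.* q'
    c : ℚ
    c = Grover.twoOver (Hamming (suc e) q) N

  first-coordinate : Vec (Fin q) (suc e) → ℚ
  first-coordinate (a ∷ _) = ⟦ a Fin.≟ zero ⟧ - ⟦ a Fin.≟ suc zero ⟧

  -- This is d (q - 1) - q, because d (q - 1) = e q' + q' and q = q' + 1.
  θ : ℚ
  θ = ℕ→ℚ (e ℕ.* q') - 1ℚ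

  -- The function ignores the tail, which therefore contributes the degree `e * q'`; its values over
  -- all heads sum to zero, so the head contributes -1.
  first-coordinate-eigen : ∀ u → 𝐀 (suc e) first-coordinate u ≡ θ * first-coordinate u
  first-coordinate-eigen (a ∷ x) = begin
    𝐀 (suc e) first-coordinate (a ∷ x)
      ≡⟨ 𝐀-∷ e first-coordinate a x ⟩
    𝐀 e (λ _ → φ a) x + (∑ (allFin q) φ - φ a)
      ≡⟨ cong₂ (λ s t → s + (t - φ a)) (𝐀-const e (φ a) x) ∑φ≡0 ⟩
    ℕ→ℚ (e ℕ.* q') * φ a + (0ℚ - φ a)
      ≡⟨ solve 2 (λ m x → m :* x :+ (con 0ℚ :- x) := (m :- con 1ℚ) :* x) refl (ℕ→ℚ (e ℕ.* q')) (φ a) ⟩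
    θ * φ a ∎
    where
    open ≡-Reasoning
    φ : Fin q → ℚ
    φ a = ⟦ a Fin.≟ zero ⟧ - ⟦ a Fin.≟ suc zero ⟧
    ∑δ : ∀ b → ∑[ a ∈ allFin q ] (⟦ a Fin.≟ b ⟧ * 1ℚ) ≡ 1ℚ
    ∑δ b = ∑-sift Fin._≟_ (λ _ → 1ℚ) (Unique.allFin⁺ q) (∈-allFin b)
    ∑φ≡0 : ∑ (allFin q) φ ≡ 0ℚ
    ∑φ≡0 = begin
      ∑ (allFin q) φ
        ≡⟨ ∑-cong (allFin q) (λ a → solve 2 (λ x y → x :- y := con 1ℚ :* (x :* con 1ℚ) :- y :* con 1ℚ) refl ⟦ a Fin.≟ zero ⟧ ⟦ a Fin.≟ suc zero ⟧) ⟩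
      ∑[ a ∈ allFin q ] (1ℚ * (⟦ a Fin.≟ zero ⟧ * 1ℚ) - ⟦ a Fin.≟ suc zero ⟧ * 1ℚ)
        ≡⟨ ∑-linear (allFin q) 1ℚ (λ a → ⟦ a Fin.≟ zero ⟧ * 1ℚ) (λ a → ⟦ a Fin.≟ suc zero ⟧ * 1ℚ) ⟩
      1ℚ * ∑[ a ∈ allFin q ] (⟦ a Fin.≟ zero ⟧ * 1ℚ) - ∑[ a ∈ allFin q ] (⟦ a Fin.≟ suc zero ⟧ * 1ℚ)
        ≡⟨ cong₂ (λ x y → 1ℚ * x - y) (∑δ zero) (∑δ (suc zero)) ⟩
      0ℚ ∎

  private
    V : List (Vec (Fin q) (suc e))
    V = allVecs q (suc e)
    -- The eigenvector is 1 at `b` and -1 at `a`, so that `y` starts with -1 and 1, as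
    -- `IntegerRecurrence` requires.
    b a : Vec (Fin q) (suc e)
    b = zero ∷ Vec.replicate e zero
    a = suc zero ∷ Vec.replicate e zero
    a~b : hdist a b ≡ 1
    a~b = cong suc (hdist-refl (Vec.replicate e zero))
    s : ℚ
    s = c * θ
    y : ℕ → ℚ
    y n = ∑[ u ∈ V ] (first-coordinate u * flow (a , b) n u)

  y-δ : ∀ n v → (∀ u → flow (a , b) n u ≡ ⟦ u ≟ⱽ v ⟧) → y n ≡ first-coordinate v
  y-δ n v flow≡δ = trans
    (∑-cong V λ u → trans (*-congˡ (first-coordinate u) (flow≡δ u)) (*-comm (first-coordinate u) ⟦ u ≟ⱽ v ⟧))
    (∑-sift _≟ⱽ_ first-coordinate (allVecs! q (suc e)) (∈-allVecs v))

  y-recurrence : ∀ n → y (2 ℕ.+ n) ≡ s * y (1 ℕ.+ n) - y n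
  y-recurrence n = begin
    ∑[ u ∈ V ] (φ u * flow (a , b) (2 ℕ.+ n) u)
      ≡⟨ ∑-cong V (λ u → trans (*-congˡ (φ u) (flow-recurrence (a , b) n u))
           (solve 4 (λ f c x z → f :* (c :* x :- z) := c :* (f :* x) :- f :* z) refl (φ u) c (𝐀 (suc e) F u) (flow (a , b) n u))) ⟩
    ∑[ u ∈ V ] (c * (φ u * 𝐀 (suc e) F u) - φ u * flow (a , b) n u)
      ≡⟨ ∑-linear V c _ _ ⟩
    c * (∑[ u ∈ V ] (φ u * 𝐀 (suc e) F u)) - y n
      ≡⟨ cong (λ z → c * z - y n) (begin
           ∑[ u ∈ V ] (φ u * 𝐀 (suc e) F u) ≡⟨ adjacency-symmetric φ F ⟩
           ∑[ u ∈ V ] (𝐀 (suc e) φ u * F u) ≡⟨ ∑-cong V (λ u → trans (*-congʳ (F u) (first-coordinate-eigen u)) (*-assoc θ (φ u) (F u))) ⟩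
           ∑[ u ∈ V ] (θ * (φ u * F u))     ≡⟨ ∑-*ˡ V θ _ ⟩
           θ * y (1 ℕ.+ n)                  ∎) ⟩
    c * (θ * y (1 ℕ.+ n)) - y n
      ≡⟨ cong (_- y n) (*-assoc c θ (y (1 ℕ.+ n))) ⟨
    s * y (1 ℕ.+ n) - y n ∎
    where
    open ≡-Reasoning
    φ = first-coordinate
    F = flow (a , b) (1 ℕ.+ n)

  recurrent⇒integral : ∀ {n} → 1 ≤ n → Recurrent n → ∃ λ m → s ≡ ι m
  recurrent⇒integral {n} 1≤n rec = IntegerRecurrence.integral s y (y-δ 0 a (flow-0 a~b)) y₁ y-recurrence 1≤n (trans y₁₊ₙ≡y₁ y₁)
    where
    y₁ : y 1 ≡ 1ℚ
    y₁ = y-δ 1 b (flow-1 a~b)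
    y₁₊ₙ≡y₁ : y (suc n) ≡ y 1
    -- The flows at `suc n` and 1 are the inflows of `evolve (a , b) n` and `evolve (a , b) 0`,
    -- which agree on arcs.
    y₁₊ₙ≡y₁ = ∑-cong V λ u → *-congˡ (first-coordinate u) (inflow-cong (λ {x} {y} x~y → rec a b x y a~b x~y) u)

  -- Since c N = 2 and θ = N - q, multiplying s = m by N gives m N + 2 q = 2 N.
  integral⇒∣ : (∃ λ m → s ≡ ι m) → N ∣ 2 ℕ.* q
  integral⇒∣ (m , s≡m) = Signed.∣⇒∣ᵤ (Signed.∣m+n∣m⇒∣n {m = m ℤ.* ℤ.+ N} {n = ℤ.+ (2 ℕ.* q)}
      (subst (ℤ.+ N Signed.∣_) (sym m*N+2q≡2N) (Signed.∣n⇒∣m*n (ℤ.+ 2) Signed.∣-refl)) (Signed.∣n⇒∣m*n m Signed.∣-refl))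
    where
    open ≡-Reasoning
    2ℚ = 1ℚ + 1ℚ
    m*N+2q≡2N : m ℤ.* ℤ.+ N ℤ.+ ℤ.+ (2 ℕ.* q) ≡ ℤ.+ 2 ℤ.* ℤ.+ N
    m*N+2q≡2N = ι-injective (begin
      ι (m ℤ.* ℤ.+ N ℤ.+ ℤ.+ (2 ℕ.* q))
        ≡⟨ trans (ι-+ (m ℤ.* ℤ.+ N) (ℤ.+ (2 ℕ.* q))) (cong₂ _+_ (trans (ι-* m (ℤ.+ N)) (*-congʳ (ℕ→ℚ N) (sym s≡m))) (trans (cong ι (ℤ.pos-* 2 q)) (ι-* (ℤ.+ 2) (ℤ.+ q)))) ⟩
      (c * θ) * ℕ→ℚ N + 2ℚ * ℕ→ℚ q
        ≡⟨ solve 4 (λ c t n q → (c :* t) :* n :+ con 2ℚ :* q := (c :* n) :* t :+ con 2ℚ :* q) refl c θ (ℕ→ℚ N) (ℕ→ℚ q) ⟩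
      (c * ℕ→ℚ N) * θ + 2ℚ * ℕ→ℚ q
        ≡⟨ cong₂ (λ x z → x * θ + 2ℚ * z) c*k≡2 (ℕ→ℚ-suc q') ⟩
      2ℚ * (ℕ→ℚ (e ℕ.* q') - 1ℚ) + 2ℚ * (1ℚ + ℕ→ℚ q')
        ≡⟨ solve 2 (λ x z → con 2ℚ :* (x :- con 1ℚ) :+ con 2ℚ :* (con 1ℚ :+ z) := con 2ℚ :* (z :+ x)) refl (ℕ→ℚ (e ℕ.* q')) (ℕ→ℚ q') ⟩
      2ℚ * (ℕ→ℚ q' + ℕ→ℚ (e ℕ.* q'))
        ≡⟨ *-congˡ 2ℚ (ι-+ (ℤ.+ q') (ℤ.+ (e ℕ.* q'))) ⟨
      2ℚ * ℕ→ℚ N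
        ≡⟨ ι-* (ℤ.+ 2) (ℤ.+ N) ⟨
      ι (ℤ.+ 2 ℤ.* ℤ.+ N) ∎)

-- The divisibility condition on `d` and `q`

Exceptional : ℕ → ℕ → Set
Exceptional d q = (d ≡ 1 × q ≡ 2) ⊎ (d ≡ 1 × q ≡ 3) ⊎ (d ≡ 2 × q ≡ 2) ⊎ (d ≡ 3 × q ≡ 3) ⊎ (d ≡ 4 × q ≡ 2)

exceptional-2 : ∀ e → suc e ℕ.* 1 ∣ 4 → Exceptional (suc e) 2
exceptional-2 0 _ = inj₁ (refl , refl)
exceptional-2 1 _ = inj₂ (inj₂ (inj₁ (refl , refl)))
exceptional-2 2 3∣4 = contradiction 3∣4 (from-no (3 ℕ.∣? 4))
exceptional-2 3 _ = inj₂ (inj₂ (inj₂ (inj₂ (refl , refl))))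
exceptional-2 (suc (suc (suc (suc e)))) N∣4 = contradiction (ℕ.∣⇒≤ N∣4)
  (ℕ.<⇒≱ (ℕ.≤-trans (ℕ.m≤m+n 5 e) (ℕ.≤-reflexive (sym (ℕ.*-identityʳ (5 ℕ.+ e))))))

exceptional-3 : ∀ e → suc e ℕ.* 2 ∣ 6 → Exceptional (suc e) 3
exceptional-3 0 _ = inj₂ (inj₁ (refl , refl))
exceptional-3 1 4∣6 = contradiction 4∣6 (from-no (4 ℕ.∣? 6))
exceptional-3 2 _ = inj₂ (inj₂ (inj₂ (inj₁ (refl , refl))))
exceptional-3 (suc (suc (suc e))) N∣6 = contradiction (ℕ.∣⇒≤ N∣6) (ℕ.<⇒≱ (ℕ.m≤m+n 7 (1 ℕ.+ e ℕ.* 2)))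

-- q - 1 divides 2 q = 2 (q - 1) + 2, hence divides 2, which leaves q = 2 and q = 3; there `d`
-- divides 4 and 2 d divides 6 respectively.
∣⇒exceptional : ∀ e p → suc e ℕ.* suc p ∣ 2 ℕ.* (2 ℕ.+ p) → Exceptional (suc e) (2 ℕ.+ p)
∣⇒exceptional e 0             = exceptional-2 e
∣⇒exceptional e 1             = exceptional-3 e
∣⇒exceptional e p@(suc (suc _)) N∣2q = contradiction (ℕ.∣⇒≤ q'∣2) (ℕ.<⇒≱ (ℕ.m≤m+n 3 _))
  where
  q'∣2 : suc p ∣ 2
  q'∣2 = ℕ.∣m+n∣m⇒∣n {m = 2 ℕ.* suc p}
    (subst (suc p ∣_) (trans (ℕ.*-suc 2 (suc p)) (ℕ.+-comm 2 (2 ℕ.* suc p))) (ℕ.∣-trans (ℕ.n∣m*n (suc e)) N∣2q))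
    (ℕ.n∣m*n 2)

periodic⇒exceptional : ∀ e p → IsPeriodic (Hamming (suc e) (2 ℕ.+ p)) → Exceptional (suc e) (2 ℕ.+ p)
periodic⇒exceptional e p per = ∣⇒exceptional e p (integral⇒∣ (recurrent⇒integral (proj₁ (proj₂ rec)) (proj₂ (proj₂ rec))))
  where
  open FirstCoordinate e p
  rec : ∃ λ n → 1 ≤ n × HammingGraph.Recurrent e p n
  rec = HammingGraph.periodic⇒recurrent e p per

-- Sufficiency: radial flows as finite tables

at : ∀ {n} → Vec ℚ n → ℕ → ℚ
-- This default is read by `radial` at j = d, where the entry d + 1 has coefficient d - j = 0.
at []       _       = 0ℚ
at (x ∷ xs) zero    = x
at (x ∷ xs) (suc j) = at xs j

at-tabulate : ∀ n (f : ℕ → ℚ) {j} → j ℕ.< n → at (Vec.tabulate {n = n} (λ i → f (Fin.toℕ i))) j ≡ f j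
at-tabulate (suc n) f {zero}  _           = refl
at-tabulate (suc n) f {suc j} (ℕ.s≤s j<n) = at-tabulate n (f ∘ suc) j<n

δ : ℕ → ℚ
δ j = ⟦ j ℕ.≟ 0 ⟧

module RadialFlow (e p : ℕ) where
  open HammingGraph e p
  private
    d q' : ℕ
    d = suc e
    q' = suc p
    c : ℚ
    c = Grover.twoOver (Hamming d (suc q')) (d ℕ.* q')
    Vertex : Set
    Vertex = Vec (Fin (suc q')) d

  next : Vec ℚ (suc d) → Vec ℚ (suc d) → Vec ℚ (suc d)
  next f g = Vec.tabulate (λ i → c * radial q' d (at f) (Fin.toℕ i) - at g (Fin.toℕ i))

  -- The radial part of P, as a table on {0,…,d} instead of a function on ℕ, and with next applied
  -- to whole tables, so that evaluation shares the earlier rows.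
  row : ℕ → Vec ℚ (suc d)
  row zero          = Vec.tabulate (λ i → - δ (Fin.toℕ i))
  row (suc zero)    = Vec.tabulate (λ i → 0ℚ)
  row (suc (suc n)) = next (row (suc n)) (row n)

  -- On distances up to `d`, `ρ n` is the Chebyshev polynomial of the second kind of degree n - 2 in
  -- c A / 2, applied to the indicator of a vertex; the polynomials of index -2 and -1 are -1 and 0.
  ρ : ℕ → ℕ → ℚ
  ρ n = at (row n)

  ρ-recurrence : ∀ n {j} → j ≤ d → ρ (2 ℕ.+ n) j ≡ c * radial q' d (ρ (1 ℕ.+ n)) j - ρ n j
  ρ-recurrence n j≤d = at-tabulate (suc d) (λ j → c * radial q' d (ρ (suc n)) j - ρ n j) (ℕ.s≤s j≤d)

  ρ-sum : ℕ → ℕ → ℕ → ℚ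
  ρ-sum i zero    j = 0ℚ
  ρ-sum i (suc m) j = ρ-sum i m j + ρ (m ℕ.* 2 ℕ.+ i) j

  ⟦⟧≡δ : ∀ (x y : Vertex) → ⟦ x ≟ⱽ y ⟧ ≡ δ (hdist x y)
  ⟦⟧≡δ x y = ⟦⟧-cong (x ≟ⱽ y) (hdist x y ℕ.≟ 0) (λ { refl → hdist-refl x }) (hdist≡0⇒≡ x y)

  ρ₀ : ∀ {j} → j ≤ d → ρ 0 j ≡ - δ j
  ρ₀ j≤d = at-tabulate (suc d) (λ j → - δ j) (ℕ.s≤s j≤d)

  ρ₁ : ∀ {j} → j ≤ d → ρ 1 j ≡ 0ℚ
  ρ₁ j≤d = at-tabulate (suc d) (λ _ → 0ℚ) (ℕ.s≤s j≤d)

  module _ (ρ₂ : ∀ {j} → j ≤ d → ρ 2 j ≡ δ j) where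

    -- Both sides obey the recurrence of `flow-recurrence` and agree at 0 and 1. Starting `ρ` from
    -- `- δ` makes the formula hold at 0 as well.
    flow≡ρ : ∀ {a b} → hdist a b ≡ 1 → ∀ n u → flow (a , b) n u ≡ ρ (1 ℕ.+ n) (hdist u b) - ρ n (hdist u a)
    flow≡ρ {a} {b} a~b zero u = begin
      flow (a , b) 0 u                     ≡⟨ flow-0 a~b u ⟩
      ⟦ u ≟ⱽ a ⟧                           ≡⟨ ⟦⟧≡δ u a ⟩
      δ (hdist u a)                        ≡⟨ solve 1 (λ x → x := con 0ℚ :- (:- x)) refl (δ (hdist u a)) ⟩
      0ℚ - (- δ (hdist u a))               ≡⟨ cong₂ _-_ (ρ₁ (hdist≤d u b)) (ρ₀ (hdist≤d u a)) ⟨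
      ρ 1 (hdist u b) - ρ 0 (hdist u a)    ∎
      where open ≡-Reasoning
    flow≡ρ {a} {b} a~b (suc zero) u = begin
      flow (a , b) 1 u                     ≡⟨ flow-1 a~b u ⟩
      ⟦ u ≟ⱽ b ⟧                           ≡⟨ ⟦⟧≡δ u b ⟩
      δ (hdist u b)                        ≡⟨ solve 1 (λ x → x := x :- con 0ℚ) refl (δ (hdist u b)) ⟩
      δ (hdist u b) - 0ℚ                   ≡⟨ cong₂ _-_ (ρ₂ (hdist≤d u b)) (ρ₁ (hdist≤d u a)) ⟨
      ρ 2 (hdist u b) - ρ 1 (hdist u a)    ∎
      where open ≡-Reasoning
    flow≡ρ {a} {b} a~b (suc (suc n)) u = begin
      flow (a , b) (2 ℕ.+ n) u
        ≡⟨ flow-recurrence (a , b) n u ⟩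
      c * 𝐀 d (flow (a , b) (1 ℕ.+ n)) u - flow (a , b) n u
        ≡⟨ cong₂ (λ x y → c * x - y) (trans (∑-cong (allVecs (suc q') d) λ w → *-congˡ ⟦ hdist u w ℕ.≟ 1 ⟧ (flow≡ρ a~b (suc n) w)) 𝐀-difference) (flow≡ρ a~b n u) ⟩
      c * (R (2 ℕ.+ n) b - R (1 ℕ.+ n) a) - (ρ (1 ℕ.+ n) (hdist u b) - ρ n (hdist u a))
        ≡⟨ solve 5 (λ c x y z w → c :* (x :- y) :- (z :- w) := (c :* x :- z) :- (c :* y :- w)) refl
             c (R (2 ℕ.+ n) b) (R (1 ℕ.+ n) a) (ρ (1 ℕ.+ n) (hdist u b)) (ρ n (hdist u a)) ⟩
      (c * R (2 ℕ.+ n) b - ρ (1 ℕ.+ n) (hdist u b)) - (c * R (1 ℕ.+ n) a - ρ n (hdist u a))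
        ≡⟨ cong₂ _-_ (ρ-recurrence (suc n) (hdist≤d u b)) (ρ-recurrence n (hdist≤d u a)) ⟨
      ρ (3 ℕ.+ n) (hdist u b) - ρ (2 ℕ.+ n) (hdist u a) ∎
      where
      open ≡-Reasoning
      R : ℕ → Vertex → ℚ
      R m v = radial q' d (ρ m) (hdist u v)
      f g : Vertex → ℚ
      f w = ρ (2 ℕ.+ n) (hdist w b)
      g w = ρ (1 ℕ.+ n) (hdist w a)
      𝐀-difference : 𝐀 d (λ w → f w - g w) u ≡ R (2 ℕ.+ n) b - R (1 ℕ.+ n) a
      𝐀-difference = begin
        𝐀 d (λ w → f w - g w) u
          ≡⟨ ∑-cong (allVecs (suc q') d) (λ w → solve 3 (λ i x y → i :* (x :- y) := con 1ℚ :* (i :* x) :- i :* y) refl ⟦ hdist u w ℕ.≟ 1 ⟧ (f w) (g w)) ⟩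
        ∑[ w ∈ allVecs (suc q') d ] (1ℚ * (⟦ hdist u w ℕ.≟ 1 ⟧ * f w) - ⟦ hdist u w ℕ.≟ 1 ⟧ * g w)
          ≡⟨ ∑-linear (allVecs (suc q') d) 1ℚ (λ w → ⟦ hdist u w ℕ.≟ 1 ⟧ * f w) (λ w → ⟦ hdist u w ℕ.≟ 1 ⟧ * g w) ⟩
        1ℚ * 𝐀 d f u - 𝐀 d g u
          ≡⟨ cong₂ _-_ (trans (*-identityˡ (𝐀 d f u)) (𝐀-radial d (ρ (2 ℕ.+ n)) b u)) (𝐀-radial d (ρ (1 ℕ.+ n)) a u) ⟩
        R (2 ℕ.+ n) b - R (1 ℕ.+ n) a ∎

    -- `evolve-2+` telescoped, with each flow split by `flow≡ρ`: `u` contributes indices n + 3 at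
    -- `b` and n + 2 at `a`, and `v` contributes n + 2 at `b` and n + 1 at `a`.
    evolve-even : ∀ {a b} → hdist a b ≡ 1 → ∀ m u v → evolve (a , b) (m ℕ.* 2) (u , v) ≡
      evolve (a , b) 0 (u , v) + c * ((ρ-sum 3 m (hdist u b) + ρ-sum 1 m (hdist v a)) - (ρ-sum 2 m (hdist u a) + ρ-sum 2 m (hdist v b)))
    evolve-even {a} {b} a~b zero u v = solve 2 (λ x c → x := x :+ c :* ((con 0ℚ :+ con 0ℚ) :- (con 0ℚ :+ con 0ℚ))) refl (evolve (a , b) 0 (u , v)) c
    evolve-even {a} {b} a~b (suc m) u v = begin
      evolve (a , b) (2 ℕ.+ n) (u , v)
        ≡⟨ evolve-2+ (a , b) n u v ⟩
      evolve (a , b) n (u , v) + c * (flow (a , b) (2 ℕ.+ n) u - flow (a , b) (1 ℕ.+ n) v)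
        ≡⟨ cong₂ (λ x y → x + c * y) (evolve-even a~b m u v) (cong₂ _-_ (flow≡ρ a~b (2 ℕ.+ n) u) (flow≡ρ a~b (1 ℕ.+ n) v)) ⟩
      (x₀ + c * ((s₃ + s₁) - (s₂ + s₂′))) + c * ((ρ (3 ℕ.+ n) (hdist u b) - ρ (2 ℕ.+ n) (hdist u a)) - (ρ (2 ℕ.+ n) (hdist v b) - ρ (1 ℕ.+ n) (hdist v a)))
        ≡⟨ solve 10 (λ x c s₃ s₁ s₂ s₂′ r₃ r₂ r₂′ r₁ →
             (x :+ c :* ((s₃ :+ s₁) :- (s₂ :+ s₂′))) :+ c :* ((r₃ :- r₂) :- (r₂′ :- r₁)) :=
             x :+ c :* (((s₃ :+ r₃) :+ (s₁ :+ r₁)) :- ((s₂ :+ r₂) :+ (s₂′ :+ r₂′)))) refl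
             x₀ c s₃ s₁ s₂ s₂′ (ρ (3 ℕ.+ n) (hdist u b)) (ρ (2 ℕ.+ n) (hdist u a)) (ρ (2 ℕ.+ n) (hdist v b)) (ρ (1 ℕ.+ n) (hdist v a)) ⟩
      x₀ + c * (((s₃ + ρ (3 ℕ.+ n) (hdist u b)) + (s₁ + ρ (1 ℕ.+ n) (hdist v a))) - ((s₂ + ρ (2 ℕ.+ n) (hdist u a)) + (s₂′ + ρ (2 ℕ.+ n) (hdist v b))))
        ≡⟨ cong (λ z → x₀ + c * z) (cong₂ _-_
             (cong₂ _+_ (shift 3 (hdist u b)) (shift 1 (hdist v a)))
             (cong₂ _+_ (shift 2 (hdist u a)) (shift 2 (hdist v b)))) ⟩
      x₀ + c * ((ρ-sum 3 (suc m) (hdist u b) + ρ-sum 1 (suc m) (hdist v a)) - (ρ-sum 2 (suc m) (hdist u a) + ρ-sum 2 (suc m) (hdist v b))) ∎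
      where
      open ≡-Reasoning
      n = m ℕ.* 2
      x₀ s₃ s₁ s₂ s₂′ : ℚ
      x₀ = evolve (a , b) 0 (u , v)
      s₃ = ρ-sum 3 m (hdist u b)
      s₁ = ρ-sum 1 m (hdist v a)
      s₂ = ρ-sum 2 m (hdist u a)
      s₂′ = ρ-sum 2 m (hdist v b)
      shift : ∀ i j → ρ-sum i m j + ρ (i ℕ.+ n) j ≡ ρ-sum i (suc m) j
      shift i j = cong (λ k → ρ-sum i m j + ρ k j) (ℕ.+-comm i n)

  -- In the exceptional cases the eigenvalues of c 𝐀 lie in {0, ±1, ±2}.  For m = 6 the
  -- contribution of 0 and ±1 to the three sums cancels, and at the eigenvalue 2 the
  -- recurrence gives ρ n = n - 1, with sums m (m - 1), m m and m (m + 1).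
  BalancedAt : ℕ → (ℕ → ℚ) → ℕ → Set
  BalancedAt m w j = ρ 2 j ≡ δ j × ρ-sum 1 m j ≡ (ℕ→ℚ m - 1ℚ) * w j ×
                     ρ-sum 2 m j ≡ ℕ→ℚ m * w (suc j) × ρ-sum 3 m j ≡ (ℕ→ℚ m + 1ℚ) * w j

  balancedAt? : ∀ m w j → Dec (BalancedAt m w j)
  balancedAt? m w j = (_ ≟ _) ×-dec (_ ≟ _) ×-dec (_ ≟ _) ×-dec (_ ≟ _)

  module _ (m : ℕ) (w : ℕ → ℚ)
    (w-flip : ∀ (x y : Vertex) → hdist x y ≡ 1 → ∀ z → w (hdist x z) ≡ w (suc (hdist y z)))
    (balanced : ∀ {j} → j ≤ d → BalancedAt m w j) where

    -- By `w-flip` along both arcs the four sums are multiples of the same `W`, with factors m + 1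
    -- and m - 1 against m and m, so the correction vanishes.
    balanced⇒recurrent : Recurrent (m ℕ.* 2)
    balanced⇒recurrent a b u v a~b u~v = begin
      evolve (a , b) (m ℕ.* 2) (u , v)
        ≡⟨ evolve-even (proj₁ ∘ balanced) a~b m u v ⟩
      x₀ + c * ((ρ-sum 3 m (hdist u b) + ρ-sum 1 m (hdist v a)) - (ρ-sum 2 m (hdist u a) + ρ-sum 2 m (hdist v b)))
        ≡⟨ cong (λ z → x₀ + c * z) (cong₂ _-_
             (cong₂ _+_ (sum₃ (hdist≤d u b)) (trans (sum₁ (hdist≤d v a)) (*-congˡ (M - 1ℚ) va≡ub)))
             (cong₂ _+_ (trans (sum₂ (hdist≤d u a)) (*-congˡ M (sym ub≡ua))) (trans (sum₂ (hdist≤d v b)) (*-congˡ M (sym ub≡vb))))) ⟩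
      x₀ + c * (((M + 1ℚ) * W + (M - 1ℚ) * W) - (M * W + M * W))
        ≡⟨ solve 4 (λ x c m w → x :+ c :* (((m :+ con 1ℚ) :* w :+ (m :- con 1ℚ) :* w) :- (m :* w :+ m :* w)) := x) refl x₀ c M W ⟩
      x₀ ∎
      where
      open ≡-Reasoning
      x₀ W M : ℚ
      x₀ = evolve (a , b) 0 (u , v)
      W = w (hdist u b)
      M = ℕ→ℚ m
      sum₁ : ∀ {j} → j ≤ d → ρ-sum 1 m j ≡ (M - 1ℚ) * w j
      sum₁ j≤d = proj₁ (proj₂ (balanced j≤d))
      sum₂ : ∀ {j} → j ≤ d → ρ-sum 2 m j ≡ M * w (suc j)
      sum₂ j≤d = proj₁ (proj₂ (proj₂ (balanced j≤d)))
      sum₃ : ∀ {j} → j ≤ d → ρ-sum 3 m j ≡ (M + 1ℚ) * w j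
      sum₃ j≤d = proj₂ (proj₂ (proj₂ (balanced j≤d)))
      flip-right : ∀ (x y : Vertex) → hdist x y ≡ 1 → ∀ z → w (hdist z x) ≡ w (suc (hdist z y))
      flip-right x y x~y z = trans (cong w (hdist-sym z x)) (trans (w-flip x y x~y z) (cong (w ∘ suc) (hdist-sym y z)))
      ub≡vb : W ≡ w (suc (hdist v b))
      ub≡vb = w-flip u v u~v b
      ub≡ua : W ≡ w (suc (hdist u a))
      ub≡ua = flip-right b a (trans (hdist-sym b a) a~b) u
      va≡ub : w (hdist v a) ≡ W
      va≡ub = trans (flip-right a b a~b v) (sym ub≡vb)

  -- For closed arguments the decision evaluates, so that `True` becomes the unit type and `_`
  -- supplies its element.
  evaluation⇒periodic : ∀ m w →
    (∀ (x y : Vertex) → hdist x y ≡ 1 → ∀ z → w (hdist x z) ≡ w (suc (hdist y z))) →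
    True (Fin.all? {n = suc d} λ i → balancedAt? (suc m) w (Fin.toℕ i)) → IsPeriodic (Hamming d (suc q'))
  evaluation⇒periodic m w w-flip evaluated = recurrent⇒periodic {suc m ℕ.* 2} (ℕ.s≤s ℕ.z≤n)
    (balanced⇒recurrent (suc m) w w-flip λ j≤d → subst (BalancedAt (suc m) w) (Fin.toℕ-fromℕ< (ℕ.s≤s j≤d))
      (toWitness evaluated (Fin.fromℕ< (ℕ.s≤s j≤d))))

-- Parity of distances, and the five exceptional graphs

odd : ℕ → Bool
odd zero    = false
odd (suc n) = not (odd n)

-- The cube is bipartite: a flipped bit agrees with `z` exactly when the old bit did not.
hdist-odd : ∀ {d} (x y : Vec (Fin 2) d) → hdist x y ≡ 1 → ∀ z → odd (hdist x z) ≡ not (odd (hdist y z))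
hdist-odd []             []             ()  _
hdist-odd (zero     ∷ x) (zero     ∷ y) x~y (zero     ∷ z) = hdist-odd x y x~y z
hdist-odd (zero     ∷ x) (zero     ∷ y) x~y (suc zero ∷ z) = cong not (hdist-odd x y x~y z)
hdist-odd (suc zero ∷ x) (suc zero ∷ y) x~y (zero     ∷ z) = cong not (hdist-odd x y x~y z)
hdist-odd (suc zero ∷ x) (suc zero ∷ y) x~y (suc zero ∷ z) = hdist-odd x y x~y z
hdist-odd (zero     ∷ x) (suc zero ∷ y) x~y (c        ∷ z) with hdist≡0⇒≡ x y (ℕ.suc-injective x~y)
hdist-odd (zero     ∷ x) (suc zero ∷ x) x~y (zero     ∷ z) | refl = sym (Bool.not-involutive _)
hdist-odd (zero     ∷ x) (suc zero ∷ x) x~y (suc zero ∷ z) | refl = refl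
hdist-odd (suc zero ∷ x) (zero     ∷ y) x~y (c        ∷ z) with hdist≡0⇒≡ x y (ℕ.suc-injective x~y)
hdist-odd (suc zero ∷ x) (zero     ∷ x) x~y (zero     ∷ z) | refl = refl
hdist-odd (suc zero ∷ x) (zero     ∷ x) x~y (suc zero ∷ z) | refl = sym (Bool.not-involutive _)

-- For q = 2 both 2 and -2 are eigenvalues of c A, with eigenvectors 1 and (-1)^j at distance j. In
-- sums over odd indices their contributions cancel at even distances and add up at odd ones; over
-- even indices it is the reverse, whence `w (suc j)` in `BalancedAt`.
onOdd : ℚ → ℕ → ℚ
onOdd κ j = if odd j then κ else 0ℚ

onOdd-flip : ∀ κ {d} (x y : Vec (Fin 2) d) → hdist x y ≡ 1 → ∀ z → onOdd κ (hdist x z) ≡ onOdd κ (suc (hdist y z))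
onOdd-flip κ x y x~y z = cong (if_then κ else 0ℚ) (hdist-odd x y x~y z)

binary-periodic : ∀ e κ → True (Fin.all? {n = 2 ℕ.+ e} λ i → RadialFlow.balancedAt? e 0 6 (onOdd κ) (Fin.toℕ i)) →
                  IsPeriodic (Hamming (suc e) 2)
-- The 5 is m - 1 for m = 6, so the exponent is 12, the least common multiple of the periods 4, 6
-- and 3 of the recurrence at the eigenvalues 0, 1 and -1.
binary-periodic e κ = RadialFlow.evaluation⇒periodic e 0 5 (onOdd κ) (onOdd-flip κ)

-- For q = 3 the least eigenvalue of c A is -1, so only the constant eigenvector of the eigenvalue 2
-- survives in the sums, and `w` is constant.
ternary-periodic : ∀ e κ → True (Fin.all? {n = 2 ℕ.+ e} λ i → RadialFlow.balancedAt? e 1 6 (λ _ → κ) (Fin.toℕ i)) →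
                   IsPeriodic (Hamming (suc e) 3)
ternary-periodic e κ = RadialFlow.evaluation⇒periodic e 1 5 (λ _ → κ) (λ _ _ _ _ → refl)

-- The constants are 12 / 2ᵈ and 6 / 3ᵈ.
exceptional⇒periodic : ∀ {d q} → Exceptional d q → IsPeriodic (Hamming d q)
exceptional⇒periodic (inj₁ (refl , refl))                      = binary-periodic 0 (ℕ→ℚ 6) _
exceptional⇒periodic (inj₂ (inj₁ (refl , refl)))               = ternary-periodic 0 (ℕ→ℚ 2) _
exceptional⇒periodic (inj₂ (inj₂ (inj₁ (refl , refl))))        = binary-periodic 1 (ℕ→ℚ 3) _
exceptional⇒periodic (inj₂ (inj₂ (inj₂ (inj₁ (refl , refl))))) = ternary-periodic 2 (ℤ.+ 2 / 9) _
exceptional⇒periodic (inj₂ (inj₂ (inj₂ (inj₂ (refl , refl))))) = binary-periodic 3 (ℤ.+ 3 / 4) _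

theorem1p3 : (d q : ℕ) → 1 ≤ d → 2 ≤ q →
    IsPeriodic (Hamming d q) ⇔
    ((d ≡ 1 × q ≡ 2) ⊎ (d ≡ 1 × q ≡ 3) ⊎ (d ≡ 2 × q ≡ 2) ⊎ (d ≡ 3 × q ≡ 3) ⊎ (d ≡ 4 × q ≡ 2))
theorem1p3 (suc e) (suc (suc p)) (ℕ.s≤s ℕ.z≤n) (ℕ.s≤s (ℕ.s≤s ℕ.z≤n)) = mk⇔ (periodic⇒exceptional e p) exceptional⇒periodic
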